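{- Let $\mathbb{K}$ be a field of characteristic zero, $n\ge1$, and $M\in M_n(\mathbb{K})$ with all principal minors nonzero. Then $\Delta(M)$ is a graded subspace of $\mathbb{K}[x_1,\dots,x_n]$ with \[ \dim_{\mathbb{K}}\Delta(M)_d=\begin{cases}\binom{n}{d}, & 0\le d\le n,\\ 0,&\text{otherwise.}\end{cases} \] In particular $\dim_{\mathbb{K}}\Delta(M)=2^n$.
   Context: Let $M=(M_{ij})$ with $i$-th row $M_i$. For $i\in[n]$ define $\Delta_i(p(\mathbf{x}))=p(\mathbf{x}-M_i)-p(\mathbf{x})$, where $\mathbf{x}-M_i=(x_1-M_{i1},\dots,x_n-M_{in})$, and $\Delta(M)=\bigcap_{i=1}^n\{p:\frac{\partial}{\partial x_i}\Delta_i(p)=0\}$ (the polynomials $p$ for which $\Delta_i(p)$ does not involve $x_i$ for all $i$). A subspace $L$ is graded if it contains the homogeneous components of each of its elements; $L_d$ denotes the subspace of its homogeneous elements of degree $d$. Principal minors are determinants of the submatrices $M_J$ indexed by nonempty $J\subseteq[n]$. -}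

module Defs where

open import Level using (Level; _⊔_)
open import Algebra.Bundles using (CommutativeRing)
open import Data.Nat as ℕ using (ℕ; zero; suc; _∸_)
open import Data.Fin as Fin using (Fin)
open import Data.Fin.Subset using (Subset; Nonempty; _∈_)
open import Data.Fin.Subset.Properties using (_∈?_)
open import Data.Vec as Vec using (Vec; []; _∷_)
open import Data.Vec.Properties using (≡-dec)
open import Data.List as List using (List; []; _∷_; _++_)
open import Data.Product using (_×_; _,_; ∃; Σ)
open import Relation.Nullary using (¬_; yes; no; does)
open import Relation.Binary.PropositionalEquality using (_≡_)

record IsField {c ℓ : Level} (R : CommutativeRing c ℓ) : Set (c ⊔ ℓ) where
  open CommutativeRing R
  field
    1≉0     : ¬ (1# ≈ 0#)
    inverse : ∀ x → ¬ (x ≈ 0#) → ∃ λ y → x * y ≈ 1#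

module Over {c ℓ : Level} (R : CommutativeRing c ℓ) where
  open CommutativeRing R renaming (Carrier to K)

  fromℕ : ℕ → K
  fromℕ zero    = 0#
  fromℕ (suc m) = 1# + fromℕ m

  CharZero : Set ℓ
  CharZero = ∀ m → ¬ (fromℕ (suc m) ≈ 0#)

  -- n×n matrices and determinants (Laplace expansion along first row)

  Matrix : ℕ → Set c
  Matrix n = Fin n → Fin n → K

  removeAt : {A : Set} → ℕ → List A → List A
  removeAt k       []       = []
  removeAt zero    (x ∷ xs) = xs
  removeAt (suc k) (x ∷ xs) = x ∷ removeAt k xs

  -- determinant of the submatrix of M with rows rs and columns cs
  -- (in the given orders; used with |rs| = |cs|)
  detRC : ∀ {n} → Matrix n → List (Fin n) → List (Fin n) → K
  detRC M []       cs = 1#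
  detRC M (r ∷ rs) cs = go 0 1# cs
    where
    go : ℕ → K → List (Fin _) → K
    go k s []       = 0#
    go k s (j ∷ js) = (s * (M r j * detRC M rs (removeAt k cs))) + go (suc k) (- s) js

  elems : ∀ {n} → Subset n → List (Fin n)
  elems J = List.filter (λ i → i ∈? J) (List.allFin _)

  principalMinor : ∀ {n} → Matrix n → Subset n → K
  principalMinor M J = detRC M (elems J) (elems J)

  -- Polynomials in K[x₁,…,xₙ], represented as finite lists of terms
  -- (coefficient, exponent vector); equality is equality of all
  -- coefficients.

  Mono : ℕ → Set
  Mono n = Vec ℕ n

  Poly : ℕ → Set c
  Poly n = List (K × Mono n)

  coeff : ∀ {n} → Poly n → Mono n → K
  coeff []             e = 0#
  coeff ((a , f) ∷ p)  e with ≡-dec ℕ._≟_ f e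
  ... | yes _ = a + coeff p e
  ... | no  _ = coeff p e

  infix 4 _≈ₚ_
  _≈ₚ_ : ∀ {n} → Poly n → Poly n → Set ℓ
  p ≈ₚ q = ∀ e → coeff p e ≈ coeff q e

  0ₚ : ∀ {n} → Poly n
  0ₚ = []

  const : ∀ {n} → K → Poly n
  const a = (a , Vec.replicate _ 0) ∷ []

  var : ∀ {n} → Fin n → Poly n
  var i = (1# , Vec.updateAt (Vec.replicate _ 0) i (λ _ → 1)) ∷ []

  infixl 6 _+ₚ_ _-ₚ_
  infixl 7 _*ₚ_ _·ₚ_
  _+ₚ_ : ∀ {n} → Poly n → Poly n → Poly n
  p +ₚ q = p ++ q

  _·ₚ_ : ∀ {n} → K → Poly n → Poly n
  a ·ₚ p = List.map (λ { (b , e) → (a * b , e) }) p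

  -ₚ_ : ∀ {n} → Poly n → Poly n
  -ₚ p = (- 1#) ·ₚ p

  _-ₚ_ : ∀ {n} → Poly n → Poly n → Poly n
  p -ₚ q = p +ₚ (-ₚ q)

  _*ₚ_ : ∀ {n} → Poly n → Poly n → Poly n
  p *ₚ q = List.concatMap (λ { (a , e) → List.map (λ { (b , f) → (a * b , Vec.zipWith ℕ._+_ e f) }) q }) p

  _^ₚ_ : ∀ {n} → Poly n → ℕ → Poly n
  p ^ₚ zero  = const 1#
  p ^ₚ suc k = p *ₚ (p ^ₚ k)

  shiftMono : ∀ {n} → (Fin n → K) → Mono n → Poly n
  shiftMono {n} v e =
    List.foldr _*ₚ_ (const 1#)
      (List.map (λ j → (var j -ₚ const (v j)) ^ₚ Vec.lookup e j) (List.allFin n))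

  shift : ∀ {n} → (Fin n → K) → Poly n → Poly n
  shift v p = List.foldr _+ₚ_ 0ₚ (List.map (λ { (a , e) → a ·ₚ shiftMono v e }) p)

  Δᵢ : ∀ {n} → Matrix n → Fin n → Poly n → Poly n
  Δᵢ M i p = shift (M i) p -ₚ p

  ∂ : ∀ {n} → Fin n → Poly n → Poly n
  ∂ i p = List.map (λ { (a , e) → (fromℕ (Vec.lookup e i) * a , Vec.updateAt e i (λ k → k ∸ 1)) }) p

  InΔ : ∀ {n} → Matrix n → Poly n → Set ℓ
  InΔ {n} M p = ∀ (i : Fin n) → ∂ i (Δᵢ M i p) ≈ₚ 0ₚ

  deg : ∀ {n} → Mono n → ℕ
  deg e = Vec.sum e

  -- p is homogeneous of degree d (the zero polynomial counts)
  Homogeneous : ∀ {n} → ℕ → Poly n → Set ℓ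
  Homogeneous d p = ∀ e → ¬ (deg e ≡ d) → coeff p e ≈ 0#

  component : ∀ {n} → ℕ → Poly n → Poly n
  component d p = List.filter (λ t → deg (Data.Product.proj₂ t) ℕ.≟ d) p

  IsSubspace : ∀ {n} {ℓ'} → (Poly n → Set ℓ') → Set (c ⊔ ℓ ⊔ ℓ')
  IsSubspace L =
    (∀ {p q} → p ≈ₚ q → L p → L q) ×
    L 0ₚ ×
    (∀ {p q} → L p → L q → L (p +ₚ q)) ×
    (∀ a {p} → L p → L (a ·ₚ p))

  IsGraded : ∀ {n} {ℓ'} → (Poly n → Set ℓ') → Set (c ⊔ ℓ')
  IsGraded L = ∀ p → L p → ∀ d → L (component d p)

  _[_] : ∀ {n} {ℓ'} → (Poly n → Set ℓ') → ℕ → Poly n → Set (ℓ ⊔ ℓ')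
  (L [ d ]) p = L p × Homogeneous d p

  lincomb : ∀ {n k} → Vec K k → Vec (Poly n) k → Poly n
  lincomb []       []       = 0ₚ
  lincomb (a ∷ as) (b ∷ bs) = a ·ₚ b +ₚ lincomb as bs

  IsBasis : ∀ {n k} {ℓ'} → (Poly n → Set ℓ') → Vec (Poly n) k → Set (c ⊔ ℓ ⊔ ℓ')
  IsBasis {k = k} L b =
    (∀ j → L (Vec.lookup b j)) ×
    (∀ (a : Vec K k) → lincomb a b ≈ₚ 0ₚ → ∀ j → Vec.lookup a j ≈ 0#) ×
    (∀ p → L p → Σ (Vec K k) λ a → p ≈ₚ lincomb a b)

  HasDim : ∀ {n} {ℓ'} → (Poly n → Set ℓ') → ℕ → Set (c ⊔ ℓ ⊔ ℓ')
  HasDim {n} L k = Σ (Vec (Poly n) k) λ b → IsBasis L b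

{-# OPTIONS --safe #-}
-- Write c for the coefficients of p and Dᵢ = ∑ⱼ Mᵢⱼ ∂ⱼ. The shift by Mᵢ is
-- exp(-Dᵢ), and Dᵢ is nilpotent on polynomials, so p ∈ Δ(M) iff Dᵢ ∂ᵢ p = 0 for
-- all i. For f(e) = e! cₑ this reads ∑ⱼ Mᵢⱼ f(e + 1ᵢ + 1ⱼ) = 0, which is visibly
-- graded: f is a linear form on K[y] / (yᵢ ∑ⱼ Mᵢⱼ yⱼ).
--
-- The squarefree monomials y_J are a basis of that quotient. For i ∈ J the
-- relations give ∑_{l ∈ J} Mᵢₗ yₗ y_J = - ∑_{l ∉ J} Mᵢₗ y_{J ∪ l}, and since the
-- principal submatrix on J is invertible they express yₗ y_J (l ∈ J) through
-- squarefree monomials. Taking this as the definition of operators on the span of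
-- the y_J, uniqueness of the solutions shows that the operators commute and
-- satisfy the relations. Hence Δ(M) has the basis dual to the y_J.
--
-- Equality in K need not be decidable, so the principal submatrices are inverted
-- without searching for pivots, adjoining one row and column at a time: were the
-- next pivot zero, the rows would be dependent and the minor would vanish.
module Submission where

open import Defs
open import Level using (Level; _⊔_)
open import Algebra.Bundles using (CommutativeRing)
import Algebra.Properties.Ring
import Algebra.Properties.Semiring.Mult
import Algebra.Properties.Semiring.Sum
import Algebra.Solver.Ring
open import Algebra.Solver.Ring.AlmostCommutativeRing using (fromCommutativeRing; _-Raw-AlmostCommutative⟶_)
open import Data.Bool using (if_then_else_)
import Data.Bool.Properties as Bool
open import Data.Fin using (Fin; zero; suc)
import Data.Fin.Properties as Fin
open import Data.Fin.Subset as Subset using (Subset; inside; outside; Nonempty; ∣_∣)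
import Data.Fin.Subset.Properties as Subset
open import Data.Integer as ℤ using (ℤ; +_; -[1+_]; _⊖_; _◃_)
import Data.Integer.Properties as ℤ
open import Data.List as List using (List; []; _∷_; _++_; _∷ʳ_; length)
import Data.List.Membership.DecPropositional
open import Data.List.Membership.Propositional using (_∈_; _∉_)
import Data.List.Membership.Propositional.Properties as List
import Data.List.Properties as List
open import Data.List.Relation.Unary.All as All using ()
open import Data.List.Relation.Unary.AllPairs using ([]; _∷_)
open import Data.List.Relation.Unary.Any as Any using (here; there)
import Data.List.Relation.Unary.Any.Properties as Any
open import Data.List.Relation.Unary.Unique.Propositional using (Unique)
import Data.List.Relation.Unary.Unique.Propositional.Properties as Unique
open import Data.Maybe using (Maybe; nothing; just)
open import Data.Nat as ℕ using (ℕ; zero; suc; _∸_; _≤_; z≤n; s≤s; _<_; NonZero; _!; _^_)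
open import Data.Nat.Combinatorics using (_C_; nCk+nC[k+1]≡[n+1]C[k+1]; nCk≡nC[n∸k]; nCn≡1; k>n⇒nCk≡0)
import Data.Nat.Properties as ℕ
open import Data.Product using (_×_; _,_; ∃; Σ; proj₁; proj₂)
import Data.Sign as Sign
open import Data.Sum using (inj₁; inj₂)
open import Data.Vec as Vec using (Vec; []; _∷_; lookup; _[_]≔_; updateAt)
import Data.Vec.Properties as Vec
open import Function using (_∘_; flip; id; case_of_)
open import Relation.Binary.PropositionalEquality as ≡ using (_≡_; _≢_)
import Relation.Binary.Reasoning.Setoid
open import Relation.Nullary using (¬_; Dec; yes; no; contradiction)
open import Relation.Unary using (Pred; Decidable)

-- The quotient ring is never formed. Everything acts on functions, `φ` on subsets and `f` on
-- exponent vectors, and `T k φ J` stands for the value of `φ` on y_k y_J. Spanning is the easier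
-- half: a form that satisfies the relations and vanishes on all y_J is zero. The obstacle is the
-- other half, that arbitrary values on the y_J extend to such a form. A monomial can be reduced to
-- squarefree ones in many orders, and the extension exists because all orders agree, which is the
-- commutation of the operators. It is proved by recognising both composites as solutions of one
-- linear system. On the side of polynomials, ∂ᵢ commutes with the shift, so the condition says that
-- exp(-Dᵢ) fixes ∂ᵢ p, and nilpotency turns a fixed vector into one killed by Dᵢ. Characteristic
-- zero enters through 1/k! in the exponential and through 1/e! in the passage from linear forms
-- back to coefficients.

-- Integers in K, a ring solver, and finite sums.

module Arithmetic {c ℓ : Level} (R : CommutativeRing c ℓ) where
  open CommutativeRing R hiding (zero) renaming (Carrier to K)
  open Over R using (fromℕ)
  open Algebra.Properties.Ring ring using (-‿+-comm; -‿distribˡ-*; -‿distribʳ-*; -0#≈0#; -‿involutive)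
  open Algebra.Properties.Semiring.Mult semiring using (×-homo-+; ×1-homo-*) renaming (_×_ to _⋆_)
  open Algebra.Properties.Semiring.Sum semiring
  open Relation.Binary.Reasoning.Setoid setoid

  fromℕ≈ : ∀ m → fromℕ m ≈ m ⋆ 1#
  fromℕ≈ zero    = refl
  fromℕ≈ (suc m) = +-congˡ (fromℕ≈ m)

  fromℕ-+ : ∀ m n → fromℕ (m ℕ.+ n) ≈ fromℕ m + fromℕ n
  fromℕ-+ m n = begin
    fromℕ (m ℕ.+ n)     ≈⟨ fromℕ≈ (m ℕ.+ n) ⟩
    (m ℕ.+ n) ⋆ 1#      ≈⟨ ×-homo-+ 1# m n ⟩
    m ⋆ 1# + n ⋆ 1#     ≈⟨ +-cong (fromℕ≈ m) (fromℕ≈ n) ⟨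
    fromℕ m + fromℕ n   ∎

  fromℕ-* : ∀ m n → fromℕ (m ℕ.* n) ≈ fromℕ m * fromℕ n
  fromℕ-* m n = begin
    fromℕ (m ℕ.* n)     ≈⟨ fromℕ≈ (m ℕ.* n) ⟩
    (m ℕ.* n) ⋆ 1#      ≈⟨ ×1-homo-* m n ⟩
    m ⋆ 1# * n ⋆ 1#     ≈⟨ *-cong (fromℕ≈ m) (fromℕ≈ n) ⟨
    fromℕ m * fromℕ n   ∎

  fromℤ : ℤ → K
  fromℤ (+ n)    = fromℕ n
  fromℤ -[1+ n ] = - fromℕ (suc n)

  fromℤ-neg : ∀ i → fromℤ (ℤ.- i) ≈ - fromℤ i
  fromℤ-neg (+ zero)  = sym -0#≈0#
  fromℤ-neg (+ suc n) = refl
  fromℤ-neg -[1+ n ]  = sym (-‿involutive _)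

  fromℤ-⊖ : ∀ m n → fromℤ (m ⊖ n) ≈ fromℕ m - fromℕ n
  fromℤ-⊖ m       zero    = sym (trans (+-congˡ -0#≈0#) (+-identityʳ _))
  fromℤ-⊖ zero    (suc n) = sym (+-identityˡ _)
  fromℤ-⊖ (suc m) (suc n) = begin
    fromℤ (suc m ⊖ suc n)                        ≡⟨ ≡.cong fromℤ (ℤ.[1+m]⊖[1+n]≡m⊖n m n) ⟩
    fromℤ (m ⊖ n)                                ≈⟨ fromℤ-⊖ m n ⟩
    fromℕ m - fromℕ n                            ≈⟨ +-identityˡ _ ⟨
    0# + (fromℕ m - fromℕ n)                     ≈⟨ +-congʳ (-‿inverseʳ 1#) ⟨
    (1# - 1#) + (fromℕ m - fromℕ n)              ≈⟨ +-assoc _ _ _ ⟩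
    1# + (- 1# + (fromℕ m - fromℕ n))            ≈⟨ +-congˡ (+-assoc _ _ _) ⟨
    1# + ((- 1# + fromℕ m) - fromℕ n)            ≈⟨ +-congˡ (+-congʳ (+-comm _ _)) ⟩
    1# + ((fromℕ m - 1#) - fromℕ n)              ≈⟨ +-congˡ (+-assoc _ _ _) ⟩
    1# + (fromℕ m + (- 1# - fromℕ n))            ≈⟨ +-assoc _ _ _ ⟨
    (1# + fromℕ m) + (- 1# - fromℕ n)            ≈⟨ +-congˡ (-‿+-comm _ _) ⟩
    (1# + fromℕ m) - (1# + fromℕ n)              ∎

  fromℤ-+ : ∀ i j → fromℤ (i ℤ.+ j) ≈ fromℤ i + fromℤ j
  fromℤ-+ (+ m)    (+ n)    = fromℕ-+ m n
  fromℤ-+ (+ m)    -[1+ n ] = fromℤ-⊖ m (suc n)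
  fromℤ-+ -[1+ m ] (+ n)    = trans (fromℤ-⊖ n (suc m)) (+-comm _ _)
  fromℤ-+ -[1+ m ] -[1+ n ] = begin
    - fromℕ (suc (suc (m ℕ.+ n)))        ≡⟨ ≡.cong (λ k → - fromℕ (suc k)) (ℕ.+-suc m n) ⟨
    - fromℕ (suc m ℕ.+ suc n)            ≈⟨ -‿cong (fromℕ-+ (suc m) (suc n)) ⟩
    - (fromℕ (suc m) + fromℕ (suc n))    ≈⟨ -‿+-comm _ _ ⟨
    - fromℕ (suc m) - fromℕ (suc n)      ∎

  fromℤ-* : ∀ i j → fromℤ (i ℤ.* j) ≈ fromℤ i * fromℤ j
  fromℤ-* (+ m) (+ n) = trans (reflexive (≡.cong fromℤ (ℤ.+◃n≡+n (m ℕ.* n)))) (fromℕ-* m n)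
  fromℤ-* (+ m) -[1+ n ] = begin
    fromℤ (Sign.- ◃ m ℕ.* suc n)         ≡⟨ ≡.cong fromℤ (ℤ.-◃n≡-n (m ℕ.* suc n)) ⟩
    fromℤ (ℤ.- (+ (m ℕ.* suc n)))        ≈⟨ fromℤ-neg (+ (m ℕ.* suc n)) ⟩
    - fromℕ (m ℕ.* suc n)                ≈⟨ -‿cong (fromℕ-* m (suc n)) ⟩
    - (fromℕ m * fromℕ (suc n))          ≈⟨ -‿distribʳ-* _ _ ⟩
    fromℕ m * - fromℕ (suc n)            ∎
  fromℤ-* -[1+ m ] (+ n) = begin
    fromℤ (Sign.- ◃ suc m ℕ.* n)         ≡⟨ ≡.cong fromℤ (ℤ.-◃n≡-n (suc m ℕ.* n)) ⟩
    fromℤ (ℤ.- (+ (suc m ℕ.* n)))        ≈⟨ fromℤ-neg (+ (suc m ℕ.* n)) ⟩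
    - fromℕ (suc m ℕ.* n)                ≈⟨ -‿cong (fromℕ-* (suc m) n) ⟩
    - (fromℕ (suc m) * fromℕ n)          ≈⟨ -‿distribˡ-* _ _ ⟩
    - fromℕ (suc m) * fromℕ n            ∎
  fromℤ-* -[1+ m ] -[1+ n ] = begin
    fromℕ (suc m ℕ.* suc n)              ≈⟨ fromℕ-* (suc m) (suc n) ⟩
    fromℕ (suc m) * fromℕ (suc n)        ≈⟨ -‿involutive _ ⟨
    - - (fromℕ (suc m) * fromℕ (suc n))  ≈⟨ -‿cong (-‿distribˡ-* _ _) ⟩
    - (- fromℕ (suc m) * fromℕ (suc n))  ≈⟨ -‿distribʳ-* _ _ ⟩
    - fromℕ (suc m) * - fromℕ (suc n)    ∎

  fromℤ-morphism : ℤ.+-*-rawRing -Raw-AlmostCommutative⟶ fromCommutativeRing R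
  fromℤ-morphism = record
    { ⟦_⟧    = fromℤ
    ; +-homo = fromℤ-+
    ; *-homo = fromℤ-*
    ; -‿homo = fromℤ-neg
    ; 0-homo = refl
    ; 1-homo = +-identityʳ 1#
    }

  -- The solver compares coefficients only through such a partial test, so integer coefficients
  -- serve although equality in K may be undecidable.
  fromℤ-≟ : ∀ i j → Maybe (fromℤ i ≈ fromℤ j)
  fromℤ-≟ i j with i ℤ.≟ j
  ... | yes i≡j = just (reflexive (≡.cong fromℤ i≡j))
  ... | no  _   = nothing

  module Solver = Algebra.Solver.Ring ℤ.+-*-rawRing (fromCommutativeRing R) fromℤ-morphism fromℤ-≟

  open Solver using (solve; _:=_; _:+_; _:*_; _:-_; :-_)

  x-y≈0⇒x≈y : ∀ {x y} → x - y ≈ 0# → x ≈ y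
  x-y≈0⇒x≈y {x} {y} eq = begin
    x            ≈⟨ solve 2 (λ x y → x := (x :- y) :+ y) refl x y ⟩
    (x - y) + y  ≈⟨ +-congʳ eq ⟩
    0# + y       ≈⟨ +-identityˡ y ⟩
    y            ∎

  sum-cong : ∀ {n} {f g : Fin n → K} → (∀ i → f i ≈ g i) → sum f ≈ sum g
  sum-cong = sum-cong-≋

  sum-zero : ∀ {n} (f : Fin n → K) → (∀ i → f i ≈ 0#) → sum f ≈ 0#
  sum-zero {n} f f≈0 = trans (sum-cong f≈0) (sum-replicate-zero n)

  sum-single : ∀ {n} (f : Fin n → K) i → (∀ j → j ≢ i → f j ≈ 0#) → sum f ≈ f i
  sum-single f zero    f≈0 = trans (+-congˡ (sum-zero (f ∘ suc) (λ j → f≈0 (suc j) λ ()))) (+-identityʳ _)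
  sum-single f (suc i) f≈0 = begin
    f zero + sum (f ∘ suc)  ≈⟨ +-cong (f≈0 zero λ ()) (sum-single (f ∘ suc) i λ j j≢i → f≈0 (suc j) (j≢i ∘ Fin.suc-injective)) ⟩
    0# + f (suc i)          ≈⟨ +-identityˡ _ ⟩
    f (suc i)               ∎

  infix 8 _∙_
  _∙_ : ∀ {n} → (Fin n → K) → (Fin n → K) → K
  u ∙ v = sum (λ i → u i * v i)

  ∙-cong : ∀ {n} {u u′ v v′ : Fin n → K} → (∀ i → u i ≈ u′ i) → (∀ i → v i ≈ v′ i) → u ∙ v ≈ u′ ∙ v′
  ∙-cong u≈u′ v≈v′ = sum-cong (λ i → *-cong (u≈u′ i) (v≈v′ i))

  ∙-congʳ : ∀ {n} (u : Fin n → K) {v v′ : Fin n → K} → (∀ i → v i ≈ v′ i) → u ∙ v ≈ u ∙ v′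
  ∙-congʳ u = ∙-cong (λ _ → refl)

  ∙-comm : ∀ {n} (u v : Fin n → K) → u ∙ v ≈ v ∙ u
  ∙-comm u v = sum-cong (λ i → *-comm (u i) (v i))

  ∙-zeroʳ : ∀ {n} (u v : Fin n → K) → (∀ i → v i ≈ 0#) → u ∙ v ≈ 0#
  ∙-zeroʳ u v v≈0 = sum-zero _ (λ i → trans (*-congˡ (v≈0 i)) (zeroʳ (u i)))

  ∙-linearʳ : ∀ {n} (u v w : Fin n → K) a → u ∙ (λ i → v i + a * w i) ≈ u ∙ v + a * u ∙ w
  ∙-linearʳ u v w a = begin
    u ∙ (λ i → v i + a * w i)                        ≈⟨ sum-cong (λ i → solve 4 (λ u v a w → u :* (v :+ a :* w) := u :* v :+ a :* (u :* w)) refl (u i) (v i) a (w i)) ⟩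
    sum (λ i → u i * v i + a * (u i * w i))          ≈⟨ ∑-distrib-+ (λ i → u i * v i) _ ⟩
    u ∙ v + sum (λ i → a * (u i * w i))              ≈⟨ +-congˡ (*-distribˡ-sum a (λ i → u i * w i)) ⟨
    u ∙ v + a * u ∙ w                                ∎

  ∙-scaleʳ : ∀ {n} (u w : Fin n → K) a → u ∙ (λ i → a * w i) ≈ a * u ∙ w
  ∙-scaleʳ u w a = begin
    u ∙ (λ i → a * w i)               ≈⟨ sum-cong (λ i → solve 3 (λ u a w → u :* (a :* w) := a :* (u :* w)) refl (u i) a (w i)) ⟩
    sum (λ i → a * (u i * w i))       ≈⟨ *-distribˡ-sum a (λ i → u i * w i) ⟨
    a * u ∙ w                         ∎

  ∙-swap : ∀ {m n} (u : Fin m → K) (A : Fin m → Fin n → K) (v : Fin n → K) →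
           u ∙ (λ i → A i ∙ v) ≈ v ∙ (λ j → u ∙ (λ i → A i j))
  ∙-swap u A v = begin
    sum (λ i → u i * sum (λ j → A i j * v j))        ≈⟨ sum-cong (λ i → *-distribˡ-sum (u i) (λ j → A i j * v j)) ⟩
    sum (λ i → sum (λ j → u i * (A i j * v j)))      ≈⟨ ∑-comm (λ i j → u i * (A i j * v j)) ⟩
    sum (λ j → sum (λ i → u i * (A i j * v j)))      ≈⟨ sum-cong (λ j → sum-cong (λ i → solve 3 (λ u a v → u :* (a :* v) := v :* (u :* a)) refl (u i) (A i j) (v j))) ⟩
    sum (λ j → sum (λ i → v j * (u i * A i j)))      ≈⟨ sum-cong (λ j → *-distribˡ-sum (v j) (λ i → u i * A i j)) ⟨
    sum (λ j → v j * sum (λ i → u i * A i j))        ∎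

-- Determinants by exterior multiplication.

module Determinant {c ℓ : Level} (R : CommutativeRing c ℓ) where
  open CommutativeRing R hiding (zero) renaming (Carrier to K)
  open Over R using (Matrix; detRC; removeAt)
  open Arithmetic R
  open Solver using (solve; _:=_; _:+_; _:*_; _:-_; :-_; con)
  open Algebra.Properties.Ring ring using (-0#≈0#; -1*x≈-x)
  open Relation.Binary.Reasoning.Setoid setoid

  -- The loop of detRC is local to its definition: it is recovered here by
  -- unification, its arguments having been generalised to distinct variables.
  mutual
    laplace : ∀ {n} → Matrix n → Fin n → List (Fin n) → List (Fin n) → ℕ → K → List (Fin n) → K
    laplace M r rs cs k s js = _

    detRC-unfold : ∀ {n} (M : Matrix n) r rs c cs →
      detRC M (r ∷ rs) (c ∷ cs) ≡ 1# * (M r c * detRC M rs cs) + laplace M r rs (c ∷ cs) 1 (- 1#) cs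
    detRC-unfold M r rs c cs with c ∷ cs | 1 | - 1#
    ... | ds | k | s = ≡.refl

  -- Exterior multiplication by the linear form w, on functions of column lists.
  ε : ∀ {n} → (Fin n → K) → (List (Fin n) → K) → List (Fin n) → K
  ε w f []       = 0#
  ε w f (c ∷ cs) = w c * f cs - ε w (λ ds → f (c ∷ ds)) cs

  ε-cong : ∀ {n} (w : Fin n → K) {f g} → (∀ cs → f cs ≈ g cs) → ∀ cs → ε w f cs ≈ ε w g cs
  ε-cong w f≈g []       = refl
  ε-cong w f≈g (c ∷ cs) = +-cong (*-congˡ (f≈g cs)) (-‿cong (ε-cong w (λ ds → f≈g (c ∷ ds)) cs))

  -- The combination `a * f - g` is the shape that `ε w f (c ∷ ds)` has as a function of `ds`.
  ε-linearʳ : ∀ {n} (w : Fin n → K) a f g cs → ε w (λ ds → a * f ds - g ds) cs ≈ a * ε w f cs - ε w g cs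
  ε-linearʳ w a f g []       = solve 1 (λ a → con (+ 0) := a :* con (+ 0) :- con (+ 0)) refl a
  ε-linearʳ w a f g (c ∷ cs) = begin
    w c * (a * f cs - g cs) - ε w (λ ds → a * f (c ∷ ds) - g (c ∷ ds)) cs
      ≈⟨ +-congˡ (-‿cong (ε-linearʳ w a _ _ cs)) ⟩
    w c * (a * f cs - g cs) - (a * ε w (λ ds → f (c ∷ ds)) cs - ε w (λ ds → g (c ∷ ds)) cs)
      ≈⟨ solve 6 (λ w a f g x y → w :* (a :* f :- g) :- (a :* x :- y) := a :* (w :* f :- x) :- (w :* g :- y)) refl (w c) a (f cs) (g cs) _ _ ⟩
    a * ε w f (c ∷ cs) - ε w g (c ∷ cs) ∎

  ε-zeroʳ : ∀ {n} (w : Fin n → K) f → (∀ cs → f cs ≈ 0#) → ∀ cs → ε w f cs ≈ 0#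
  ε-zeroʳ w f f≈0 []       = refl
  ε-zeroʳ w f f≈0 (c ∷ cs) = begin
    w c * f cs - ε w (λ ds → f (c ∷ ds)) cs  ≈⟨ +-cong (*-congˡ (f≈0 cs)) (-‿cong (ε-zeroʳ w _ (λ ds → f≈0 (c ∷ ds)) cs)) ⟩
    w c * 0# - 0#                            ≈⟨ solve 1 (λ w → w :* con (+ 0) :- con (+ 0) := con (+ 0)) refl (w c) ⟩
    0#                                       ∎

  ε-zeroˡ : ∀ {n} (w : Fin n → K) f cs → (∀ {c} → c ∈ cs → w c ≈ 0#) → ε w f cs ≈ 0#
  ε-zeroˡ w f []       w≈0 = refl
  ε-zeroˡ w f (c ∷ cs) w≈0 = begin
    w c * f cs - ε w (λ ds → f (c ∷ ds)) cs  ≈⟨ +-cong (*-congʳ (w≈0 (here ≡.refl))) (-‿cong (ε-zeroˡ w _ cs (w≈0 ∘ there))) ⟩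
    0# * f cs - 0#                           ≈⟨ solve 1 (λ f → con (+ 0) :* f :- con (+ 0) := con (+ 0)) refl (f cs) ⟩
    0#                                       ∎

  ε-linearˡ : ∀ {m n} (y : Fin m → K) (A : Fin m → Fin n → K) f cs →
              ε (λ c → y ∙ (λ i → A i c)) f cs ≈ y ∙ (λ i → ε (A i) f cs)
  ε-linearˡ y A f []       = sym (∙-zeroʳ y _ (λ _ → refl))
  ε-linearˡ y A f (c ∷ cs) = begin
    y ∙ (λ i → A i c) * f cs - ε (λ c → y ∙ (λ i → A i c)) g cs
      ≈⟨ +-congˡ (-‿cong (ε-linearˡ y A g cs)) ⟩
    y ∙ (λ i → A i c) * f cs - y ∙ (λ i → ε (A i) g cs)
      ≈⟨ +-cong (*-comm _ (f cs)) (sym (-1*x≈-x _)) ⟩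
    f cs * y ∙ (λ i → A i c) + - 1# * y ∙ (λ i → ε (A i) g cs)
      ≈⟨ +-congʳ (∙-scaleʳ y _ (f cs)) ⟨
    y ∙ (λ i → f cs * A i c) + - 1# * y ∙ (λ i → ε (A i) g cs)
      ≈⟨ ∙-linearʳ y _ _ (- 1#) ⟨
    y ∙ (λ i → f cs * A i c + - 1# * ε (A i) g cs)
      ≈⟨ ∙-congʳ y (λ i → +-cong (*-comm (f cs) (A i c)) (-1*x≈-x (ε (A i) g cs))) ⟩
    y ∙ (λ i → ε (A i) f (c ∷ cs)) ∎
    where g = λ ds → f (c ∷ ds)

  -- The bracket is antisymmetric in `v` and `w`, and the last term is the same composite on a
  -- shorter list, so `ε-square` and `ε-anticomm` follow by induction on the columns. They are
  -- proved separately because 2 need not be invertible in `R`.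
  ε-ε-unfold : ∀ {n} (v w : Fin n → K) f c cs →
    ε v (ε w f) (c ∷ cs) ≈ (v c * ε w f cs - w c * ε v f cs) + ε v (ε w (λ ds → f (c ∷ ds))) cs
  ε-ε-unfold v w f c cs = begin
    v c * ε w f cs - ε v (λ ds → w c * f ds - ε w (λ ds → f (c ∷ ds)) ds) cs
      ≈⟨ +-congˡ (-‿cong (ε-linearʳ v (w c) f _ cs)) ⟩
    v c * ε w f cs - (w c * ε v f cs - ε v (ε w (λ ds → f (c ∷ ds))) cs)
      ≈⟨ solve 3 (λ x y z → x :- (y :- z) := (x :- y) :+ z) refl _ _ _ ⟩
    (v c * ε w f cs - w c * ε v f cs) + ε v (ε w (λ ds → f (c ∷ ds))) cs ∎

  ε-square : ∀ {n} (w : Fin n → K) f cs → ε w (ε w f) cs ≈ 0#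
  ε-square w f []       = refl
  ε-square w f (c ∷ cs) = begin
    ε w (ε w f) (c ∷ cs)                                                  ≈⟨ ε-ε-unfold w w f c cs ⟩
    (w c * ε w f cs - w c * ε w f cs) + ε w (ε w (λ ds → f (c ∷ ds))) cs  ≈⟨ +-cong (-‿inverseʳ _) (ε-square w _ cs) ⟩
    0# + 0#                                                               ≈⟨ +-identityˡ 0# ⟩
    0#                                                                    ∎

  ε-anticomm : ∀ {n} (v w : Fin n → K) f cs → ε v (ε w f) cs ≈ - ε w (ε v f) cs
  ε-anticomm v w f []       = sym -0#≈0#
  ε-anticomm v w f (c ∷ cs) = begin
    ε v (ε w f) (c ∷ cs)                                                      ≈⟨ ε-ε-unfold v w f c cs ⟩
    (v c * ε w f cs - w c * ε v f cs) + ε v (ε w (λ ds → f (c ∷ ds))) cs      ≈⟨ +-congˡ (ε-anticomm v w _ cs) ⟩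
    (v c * ε w f cs - w c * ε v f cs) - ε w (ε v (λ ds → f (c ∷ ds))) cs      ≈⟨ solve 3 (λ x y z → (x :- y) :- z := :- ((y :- x) :+ z)) refl _ _ _ ⟩
    - ((w c * ε v f cs - v c * ε w f cs) + ε w (ε v (λ ds → f (c ∷ ds))) cs)  ≈⟨ -‿cong (ε-ε-unfold w v f c cs) ⟨
    - ε w (ε v f) (c ∷ cs)                                                    ∎

  removeAt-length : ∀ {A : Set} (xs : List A) y ys → removeAt (length xs) (xs ++ y ∷ ys) ≡ xs ++ ys
  removeAt-length []       y ys = ≡.refl
  removeAt-length (x ∷ xs) y ys = ≡.cong (x ∷_) (removeAt-length xs y ys)

  -- Loop invariant: `ds` holds the columns already passed, so the counter is `length ds` and
  -- `removeAt` deletes exactly the current column.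
  laplace-ε : ∀ {n} (M : Matrix n) r rs cs ds js → ds ++ js ≡ cs → ∀ s →
    laplace M r rs cs (length ds) s js ≈ s * ε (M r) (λ es → detRC M rs (ds ++ es)) js
  laplace-ε M r rs cs ds []       eq s = sym (zeroʳ s)
  laplace-ε M r rs cs ds (j ∷ js) ≡.refl s = begin
    s * (M r j * detRC M rs (removeAt (length ds) cs)) + laplace M r rs cs (suc (length ds)) (- s) js
      ≡⟨ ≡.cong₂ (λ es k → s * (M r j * detRC M rs es) + laplace M r rs cs k (- s) js)
           (removeAt-length ds j js) (≡.sym (≡.trans (List.length-++ ds) (ℕ.+-comm (length ds) 1))) ⟩
    s * (M r j * detRC M rs (ds ++ js)) + laplace M r rs cs (length (ds ∷ʳ j)) (- s) js
      ≈⟨ +-congˡ (laplace-ε M r rs cs (ds ∷ʳ j) js (List.++-assoc ds (j ∷ []) js) (- s)) ⟩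
    s * (M r j * detRC M rs (ds ++ js)) + - s * ε (M r) (λ es → detRC M rs ((ds ∷ʳ j) ++ es)) js
      ≈⟨ +-congˡ (*-congˡ (ε-cong (M r) (λ es → reflexive (≡.cong (detRC M rs) (List.++-assoc ds (j ∷ []) es))) js)) ⟩
    s * (M r j * detRC M rs (ds ++ js)) + - s * ε (M r) (λ es → detRC M rs (ds ++ j ∷ es)) js
      ≈⟨ solve 3 (λ s x y → s :* x :+ :- s :* y := s :* (x :- y)) refl s _ _ ⟩
    s * ε (M r) (λ es → detRC M rs (ds ++ es)) (j ∷ js) ∎

  detRC-ε : ∀ {n} (M : Matrix n) r rs cs → detRC M (r ∷ rs) cs ≈ ε (M r) (detRC M rs) cs
  detRC-ε M r rs []       = refl
  detRC-ε M r rs (c ∷ cs) = begin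
    detRC M (r ∷ rs) (c ∷ cs)
      ≡⟨ detRC-unfold M r rs c cs ⟩
    1# * (M r c * detRC M rs cs) + laplace M r rs (c ∷ cs) 1 (- 1#) cs
      ≈⟨ +-cong (*-identityˡ _) (laplace-ε M r rs (c ∷ cs) (c ∷ []) cs ≡.refl (- 1#)) ⟩
    M r c * detRC M rs cs + - 1# * ε (M r) (λ ds → detRC M rs (c ∷ ds)) cs
      ≈⟨ +-congˡ (-1*x≈-x _) ⟩
    ε (M r) (detRC M rs) (c ∷ cs) ∎

  -- This is a determinant with a repeated row. Anticommutation moves the outer factor inwards until
  -- it meets its own row, where `ε-square` applies.
  ε-row : ∀ {n} (M : Matrix n) {r} rs → r ∈ rs → ∀ cs → ε (M r) (detRC M rs) cs ≈ 0#
  ε-row M {r} (s ∷ rs) (here ≡.refl) cs = trans (ε-cong (M r) (detRC-ε M s rs) cs) (ε-square (M r) _ cs)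
  ε-row M {r} (s ∷ rs) (there r∈rs) cs = begin
    ε (M r) (detRC M (s ∷ rs)) cs        ≈⟨ ε-cong (M r) (detRC-ε M s rs) cs ⟩
    ε (M r) (ε (M s) (detRC M rs)) cs    ≈⟨ ε-anticomm (M r) (M s) _ cs ⟩
    - ε (M s) (ε (M r) (detRC M rs)) cs  ≈⟨ -‿cong (ε-zeroʳ (M s) _ (ε-row M rs r∈rs) cs) ⟩
    - 0#                                 ≈⟨ -0#≈0# ⟩
    0#                                   ∎

  -- Row `r` may be replaced by the combination with coefficients `y`: rows in `rs` contribute a
  -- repeated row, rows outside the list have coefficient zero, and `y r` is 1. The new row vanishes
  -- in every column used.
  detRC-dependent : ∀ {n} (M : Matrix n) r rs cs (y : Fin n → K) →
    y r ≈ 1# → (∀ {i} → i ∉ r ∷ rs → y i ≈ 0#) → (∀ {c} → c ∈ cs → y ∙ (λ i → M i c) ≈ 0#) →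
    detRC M (r ∷ rs) cs ≈ 0#
  detRC-dependent M r rs cs y yr≈1 y≈0 yM≈0 = begin
    detRC M (r ∷ rs) cs                              ≈⟨ detRC-ε M r rs cs ⟩
    ε (M r) (detRC M rs) cs                          ≈⟨ *-identityˡ _ ⟨
    1# * ε (M r) (detRC M rs) cs                     ≈⟨ *-congʳ yr≈1 ⟨
    y r * ε (M r) (detRC M rs) cs                    ≈⟨ sum-single _ r other ⟨
    y ∙ (λ i → ε (M i) (detRC M rs) cs)              ≈⟨ ε-linearˡ y M _ cs ⟨
    ε (λ c → y ∙ (λ i → M i c)) (detRC M rs) cs      ≈⟨ ε-zeroˡ _ _ cs yM≈0 ⟩
    0#                                               ∎
    where
    open Data.List.Membership.DecPropositional Fin._≟_ using (_∈?_)
    other : ∀ i → i ≢ r → y i * ε (M i) (detRC M rs) cs ≈ 0#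
    other i i≢r with i ∈? rs
    ... | yes i∈rs = trans (*-congˡ (ε-row M rs i∈rs cs)) (zeroʳ _)
    ... | no  i∉rs = trans (*-congʳ (y≈0 λ { (here i≡r) → i≢r i≡r ; (there i∈rs) → i∉rs i∈rs })) (zeroˡ _)

-- Bordering an invertible principal submatrix.

module LinearSystem {c ℓ : Level} (R : CommutativeRing c ℓ) where
  open CommutativeRing R hiding (zero) renaming (Carrier to K)
  open Over R using (Matrix; detRC)
  open Arithmetic R
  open Determinant R
  open Solver using (solve; _:=_; _:+_; _:*_; _:-_; :-_; con)
  open Relation.Binary.Reasoning.Setoid setoid

  Solves : ∀ {n} → Matrix n → List (Fin n) → (Fin n → K) → Set ℓ
  Solves M L g = ∀ {i} → i ∈ L → M i ∙ g ≈ 0#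

  Agree : ∀ {n} → List (Fin n) → (Fin n → K) → (Fin n → K) → Set ℓ
  Agree L g b = ∀ {l} → l ∉ L → g l ≈ b l

  -- Invertibility of the principal submatrix on L, as unique solvability of
  -- its equations for prescribed values of the unknowns outside L.
  record Regular {n} (M : Matrix n) (L : List (Fin n)) : Set (c ⊔ ℓ) where
    field
      solution : (Fin n → K) → Fin n → K
      agrees   : ∀ b → Agree L (solution b) b
      solves   : ∀ b → Solves M L (solution b)
      trivial  : ∀ g → Agree L g (λ _ → 0#) → Solves M L g → ∀ l → g l ≈ 0#

  -- When the block on `L` is invertible, `h` is determined by these conditions and `M r ∙ h` is the
  -- Schur complement of that block, the pivot met when `r` is adjoined.
  Pivot : ∀ {n} → Matrix n → Fin n → List (Fin n) → (Fin n → K) → Set ℓ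
  Pivot M r L h = (h r ≈ 1#) × Agree (r ∷ L) h (λ _ → 0#) × Solves M L h

  indicator : ∀ {n} → Fin n → Fin n → K
  indicator r l with l Fin.≟ r
  ... | yes _ = 1#
  ... | no  _ = 0#

  indicator-≡ : ∀ {n} (r : Fin n) → indicator r r ≈ 1#
  indicator-≡ r with r Fin.≟ r
  ... | yes _   = refl
  ... | no  r≢r = contradiction ≡.refl r≢r

  indicator-≢ : ∀ {n} {r l : Fin n} → l ≢ r → indicator r l ≈ 0#
  indicator-≢ {r = r} {l} l≢r with l Fin.≟ r
  ... | yes l≡r = contradiction l≡r l≢r
  ... | no  _   = refl

  pivot : ∀ {n} {M : Matrix n} {r L} → r ∉ L → Regular M L → ∃ (Pivot M r L)
  pivot {r = r} r∉L reg = solution δ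
    , trans (agrees δ r∉L) (indicator-≡ r)
    , (λ l∉ → trans (agrees δ (l∉ ∘ there)) (indicator-≢ (l∉ ∘ here)))
    , solves δ
    where
    open Regular reg
    δ = indicator r

  -- Adding a multiple of `h` changes neither the equations on `L` nor the values outside `r ∷ L`.
  -- Only row `r` remains, and it determines the multiple because `t` inverts the pivot.
  regular-∷ : ∀ {n} {M : Matrix n} {r L} → Regular M L → ∀ {h} → Pivot M r L h →
    ∀ t → M r ∙ h * t ≈ 1# → Regular M (r ∷ L)
  regular-∷ {n} {M} {r} {L} reg {h} (hr≈1 , h≈0 , Mh≈0) t st≈1 = record
    { solution = sol
    ; agrees   = sol-agrees
    ; solves   = sol-solves
    ; trivial  = sol-trivial
    }
    where
    open Regular reg
    s = M r ∙ h

    coef : (Fin n → K) → K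
    coef b = - (M r ∙ solution b * t)

    sol : (Fin n → K) → Fin n → K
    sol b l = solution b l + coef b * h l

    sol-agrees : ∀ b → Agree (r ∷ L) (sol b) b
    sol-agrees b {l} l∉ = begin
      solution b l + coef b * h l  ≈⟨ +-cong (agrees b (l∉ ∘ there)) (*-congˡ (h≈0 l∉)) ⟩
      b l + coef b * 0#            ≈⟨ solve 2 (λ b a → b :+ a :* con (+ 0) := b) refl (b l) (coef b) ⟩
      b l                          ∎

    sol-solves : ∀ b → Solves M (r ∷ L) (sol b)
    sol-solves b (here ≡.refl) = begin
      M r ∙ sol b                                        ≈⟨ ∙-linearʳ (M r) (solution b) h (coef b) ⟩
      M r ∙ solution b + - (M r ∙ solution b * t) * s    ≈⟨ solve 3 (λ x t s → x :+ :- (x :* t) :* s := x :* (con (+ 1) :- s :* t)) refl (M r ∙ solution b) t s ⟩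
      -- The solver reads `con (+ 1)` as `fromℕ 1`, which is `1# + 0#`.
      M r ∙ solution b * (1# + 0# - s * t)               ≈⟨ *-congˡ (+-congˡ (-‿cong st≈1)) ⟩
      M r ∙ solution b * (1# + 0# - 1#)                  ≈⟨ *-congˡ (trans (+-congʳ (+-identityʳ 1#)) (-‿inverseʳ 1#)) ⟩
      M r ∙ solution b * 0#                              ≈⟨ zeroʳ _ ⟩
      0#                                                 ∎
    sol-solves b {i} (there i∈L) = begin
      M i ∙ sol b                              ≈⟨ ∙-linearʳ (M i) (solution b) h (coef b) ⟩
      M i ∙ solution b + coef b * M i ∙ h      ≈⟨ +-cong (solves b i∈L) (*-congˡ (Mh≈0 i∈L)) ⟩
      0# + coef b * 0#                         ≈⟨ solve 1 (λ a → con (+ 0) :+ a :* con (+ 0) := con (+ 0)) refl (coef b) ⟩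
      0#                                       ∎

    sol-trivial : ∀ g → Agree (r ∷ L) g (λ _ → 0#) → Solves M (r ∷ L) g → ∀ l → g l ≈ 0#
    sol-trivial g g≈0 Mg≈0 l = begin
      g l                      ≈⟨ solve 3 (λ g a h → g := (g :+ :- a :* h) :+ a :* h) refl (g l) (g r) (h l) ⟩
      (g l + - g r * h l) + g r * h l  ≈⟨ +-cong (multiple l) (*-congʳ gr≈0) ⟩
      0# + 0# * h l            ≈⟨ solve 1 (λ h → con (+ 0) :+ con (+ 0) :* h := con (+ 0)) refl (h l) ⟩
      0#                       ∎
      where
      -- Subtracting `g r * h` clears the entry at `r`, so `trivial` for `L` shows that `g` is a
      -- multiple of `h`. Row `r` then forces the factor `g r` to be zero.
      off : Agree L (λ l → g l + - g r * h l) (λ _ → 0#)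
      off {l} l∉L with l Fin.≟ r
      ... | yes ≡.refl = begin
        g l + - g l * h l  ≈⟨ +-congˡ (*-congˡ hr≈1) ⟩
        g l + - g l * 1#   ≈⟨ +-congˡ (*-identityʳ _) ⟩
        g l - g l          ≈⟨ -‿inverseʳ _ ⟩
        0#                 ∎
      ... | no l≢r = begin
        g l + - g r * h l  ≈⟨ +-cong (g≈0 l∉) (*-congˡ (h≈0 l∉)) ⟩
        0# + - g r * 0#    ≈⟨ solve 1 (λ a → con (+ 0) :+ a :* con (+ 0) := con (+ 0)) refl (- g r) ⟩
        0#                 ∎
        where
        l∉ : l ∉ r ∷ L
        l∉ (here l≡r)  = l≢r l≡r
        l∉ (there l∈L) = l∉L l∈L

      multiple : ∀ l → g l + - g r * h l ≈ 0#
      multiple = trivial _ off λ {i} i∈L → begin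
        M i ∙ (λ l → g l + - g r * h l)  ≈⟨ ∙-linearʳ (M i) g h (- g r) ⟩
        M i ∙ g + - g r * M i ∙ h        ≈⟨ +-cong (Mg≈0 (there i∈L)) (*-congˡ (Mh≈0 i∈L)) ⟩
        0# + - g r * 0#                  ≈⟨ solve 1 (λ a → con (+ 0) :+ a :* con (+ 0) := con (+ 0)) refl (- g r) ⟩
        0#                               ∎

      gr≈0 : g r ≈ 0#
      gr≈0 = begin
        g r                                     ≈⟨ *-identityʳ _ ⟨
        g r * 1#                                ≈⟨ *-congˡ st≈1 ⟨
        g r * (s * t)                           ≈⟨ solve 4 (λ a s t x → a :* (s :* t) := (x :- (x :+ :- a :* s)) :* t) refl (g r) s t (M r ∙ g) ⟩
        (M r ∙ g - (M r ∙ g + - g r * s)) * t   ≈⟨ *-congʳ (+-congˡ (-‿cong (∙-linearʳ (M r) g h (- g r)))) ⟨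
        (M r ∙ g - M r ∙ (λ l → g l + - g r * h l)) * t ≈⟨ *-congʳ (+-cong (Mg≈0 (here ≡.refl)) (-‿cong (∙-zeroʳ (M r) _ multiple))) ⟩
        (0# - 0#) * t                           ≈⟨ solve 1 (λ t → (con (+ 0) :- con (+ 0)) :* t := con (+ 0)) refl t ⟩
        0#                                      ∎

  -- Both sides equal h′ᵀ M h.
  pivot-transpose : ∀ {n} {M : Matrix n} {r L h h′} → Pivot M r L h → Pivot (flip M) r L h′ →
    M r ∙ h ≈ flip M r ∙ h′
  pivot-transpose {M = M} {r} {L} {h} {h′} (hr≈1 , h≈0 , Mh≈0) (h′r≈1 , h′≈0 , h′M≈0) = begin
    M r ∙ h                                    ≈⟨ collapse h′ h′r≈1 h′≈0 (λ i → M i ∙ h) Mh≈0 ⟨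
    h′ ∙ (λ i → M i ∙ h)                       ≈⟨ ∙-swap h′ M h ⟩
    h ∙ (λ j → h′ ∙ flip M j)                  ≈⟨ ∙-congʳ h (λ j → ∙-comm h′ (flip M j)) ⟩
    h ∙ (λ j → flip M j ∙ h′)                  ≈⟨ collapse h hr≈1 h≈0 (λ j → flip M j ∙ h′) h′M≈0 ⟩
    flip M r ∙ h′                              ∎
    where
    open Data.List.Membership.DecPropositional Fin._≟_ using (_∈?_)
    collapse : ∀ u → u r ≈ 1# → Agree (r ∷ L) u (λ _ → 0#) → ∀ v → (∀ {i} → i ∈ L → v i ≈ 0#) → u ∙ v ≈ v r
    collapse u ur≈1 u≈0 v v≈0 = begin
      u ∙ v      ≈⟨ sum-single _ r other ⟩
      u r * v r  ≈⟨ *-congʳ ur≈1 ⟩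
      1# * v r   ≈⟨ *-identityˡ _ ⟩
      v r        ∎
      where
      other : ∀ i → i ≢ r → u i * v i ≈ 0#
      other i i≢r with i ∈? L
      ... | yes i∈L = trans (*-congˡ (v≈0 i∈L)) (zeroʳ _)
      ... | no  i∉L = trans (*-congʳ (u≈0 λ { (here i≡r) → i≢r i≡r ; (there i∈L) → i∉L i∈L })) (zeroˡ _)

  -- The entries of `h` are the coefficients of a combination of the rows of `M`. It vanishes in the
  -- columns of `L` by construction, and in column `r` once the pivot is zero.
  pivot-det : ∀ {n} {M : Matrix n} {r L h} → Pivot (flip M) r L h → flip M r ∙ h ≈ 0# → detRC M (r ∷ L) (r ∷ L) ≈ 0#
  pivot-det {M = M} {r} {L} {h} (hr≈1 , h≈0 , hM≈0) s≈0 = detRC-dependent M r L (r ∷ L) h hr≈1 h≈0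
    λ { (here ≡.refl) → trans (∙-comm h _) s≈0 ; (there c∈L) → trans (∙-comm h _) (hM≈0 c∈L) }

  regular-[] : ∀ {n} {M : Matrix n} → Regular M []
  regular-[] = record
    { solution = λ b → b
    ; agrees   = λ b _ → refl
    ; solves   = λ b ()
    ; trivial  = λ g g≈0 _ l → g≈0 λ ()
    }

  module _ (isField : IsField R) where
    open IsField isField

    -- The transposed system is carried along because a vanishing pivot of
    -- the transpose is what exhibits a dependency between the rows of M.
    regular²-∷ : ∀ {n} {M : Matrix n} {r L} → r ∉ L → ¬ (detRC M (r ∷ L) (r ∷ L) ≈ 0#) →
      Regular M L × Regular (flip M) L → Regular M (r ∷ L) × Regular (flip M) (r ∷ L)
    regular²-∷ {M = M} {r} {L} r∉L det≉0 (reg , regᵀ) =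
        regular-∷ reg piv t st≈1
      , regular-∷ regᵀ pivᵀ t (trans (*-congʳ (sym s≈sᵀ)) st≈1)
      where
      piv = proj₂ (pivot r∉L reg)
      pivᵀ = proj₂ (pivot r∉L regᵀ)
      s≈sᵀ = pivot-transpose piv pivᵀ
      s⁻¹ = inverse _ (λ s≈0 → det≉0 (pivot-det pivᵀ (trans (sym s≈sᵀ) s≈0)))
      t = proj₁ s⁻¹
      st≈1 = proj₂ s⁻¹

-- Filtered lists, subsets, and exponent vectors.

filter-cong : ∀ {a p q} {A : Set a} {P : Pred A p} {Q : Pred A q} (P? : Decidable P) (Q? : Decidable Q) xs →
  (∀ {x} → x ∈ xs → P x → Q x) → (∀ {x} → x ∈ xs → Q x → P x) → List.filter P? xs ≡ List.filter Q? xs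
filter-cong P? Q? []       P⇒Q Q⇒P = ≡.refl
filter-cong P? Q? (x ∷ xs) P⇒Q Q⇒P with P? x | Q? x
... | yes _  | yes _  = ≡.cong (x ∷_) (filter-cong P? Q? xs (P⇒Q ∘ there) (Q⇒P ∘ there))
... | no  _  | no  _  = filter-cong P? Q? xs (P⇒Q ∘ there) (Q⇒P ∘ there)
... | yes Px | no ¬Qx = contradiction (P⇒Q (here ≡.refl) Px) ¬Qx
... | no ¬Px | yes Qx = contradiction (Q⇒P (here ≡.refl) Qx) ¬Px

-- Before `y` both filters reject everything. After it, uniqueness excludes a second `y`, and away
-- from `y` the two predicates agree.
filter-tail : ∀ {a p q} {A : Set a} {P : Pred A p} {Q : Pred A q} (P? : Decidable P) (Q? : Decidable Q) {y ys} xs →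
  Unique xs → ¬ Q y → (∀ {x} → x ≢ y → P x → Q x) → (∀ {x} → Q x → P x) →
  List.filter P? xs ≡ y ∷ ys → List.filter Q? xs ≡ ys
filter-tail P? Q? (x ∷ xs) (x∉xs ∷ uniq) ¬Qy P⇒Q Q⇒P eq with P? x | Q? x
... | no ¬Px | no  _  = filter-tail P? Q? xs uniq ¬Qy P⇒Q Q⇒P eq
... | no ¬Px | yes Qx = contradiction (Q⇒P Qx) ¬Px
... | yes _  | yes Qx = contradiction (≡.subst _ (List.∷-injectiveˡ eq) Qx) ¬Qy
... | yes _  | no  _  = ≡.trans (≡.sym (filter-cong P? Q? xs
    (λ z∈xs → P⇒Q λ z≡y → All.lookup x∉xs z∈xs (≡.trans (List.∷-injectiveˡ eq) (≡.sym z≡y))) (λ _ → Q⇒P)))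
  (List.∷-injectiveʳ eq)

infixl 6 _⊕_ _⊝_
_⊕_ _⊝_ : ∀ {n} → Subset n → Fin n → Subset n
J ⊕ k = J [ k ]≔ inside
J ⊝ k = J [ k ]≔ outside

x∈p⊕x : ∀ {n} (p : Subset n) x → x Subset.∈ p ⊕ x
x∈p⊕x p x = Vec.[]≔-updates p x

∈-⊕⁺ : ∀ {n} {p : Subset n} {x y} → x Subset.∈ p → x Subset.∈ p ⊕ y
∈-⊕⁺ {p = p} {x} {y} x∈p with x Fin.≟ y
... | yes ≡.refl = x∈p⊕x p x
... | no  x≢y    = Vec.[]≔-minimal p x y x≢y x∈p

∈-[]≔⁻ : ∀ {n} {p : Subset n} {x y s} → x ≢ y → x Subset.∈ p [ y ]≔ s → x Subset.∈ p
∈-[]≔⁻ {p = p} {x} {y} x≢y x∈ =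
  Vec.lookup⇒[]= x p (≡.trans (≡.sym (Vec.lookup∘update′ x≢y p _)) (Vec.[]=⇒lookup x∈))

x∉p⊝x : ∀ {n} (p : Subset n) x → x Subset.∉ p ⊝ x
x∉p⊝x p x x∈ with ≡.trans (≡.sym (Vec.lookup∘update x p outside)) (Vec.[]=⇒lookup x∈)
... | ()

∈-⊝⁻ : ∀ {n} {p : Subset n} {x y} → x Subset.∈ p ⊝ y → x Subset.∈ p
∈-⊝⁻ {p = p} {x} {y} x∈ with x Fin.≟ y
... | yes ≡.refl = contradiction x∈ (x∉p⊝x p x)
... | no  x≢y    = ∈-[]≔⁻ {s = outside} x≢y x∈

∣p⊕x∣ : ∀ {n} (p : Subset n) x → x Subset.∉ p → ∣ p ⊕ x ∣ ≡ suc ∣ p ∣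
∣p⊕x∣ (outside ∷ p) zero    x∉p = ≡.refl
∣p⊕x∣ (inside  ∷ p) zero    x∉p = contradiction Vec.here x∉p
∣p⊕x∣ (outside ∷ p) (suc x) x∉p = ∣p⊕x∣ p x (x∉p ∘ Vec.there)
∣p⊕x∣ (inside  ∷ p) (suc x) x∉p = ≡.cong suc (∣p⊕x∣ p x (x∉p ∘ Vec.there))

inc : ∀ {n} → Fin n → Vec ℕ n → Vec ℕ n
inc j e = updateAt e j suc

squarefree : ∀ {n} → Subset n → Vec ℕ n
squarefree = Vec.map (if_then 1 else 0)

inc-squarefree : ∀ {n} (J : Subset n) k → k Subset.∉ J → inc k (squarefree J) ≡ squarefree (J ⊕ k)
inc-squarefree (outside ∷ J) zero    k∉J = ≡.refl
inc-squarefree (inside  ∷ J) zero    k∉J = contradiction Vec.here k∉J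
inc-squarefree (x       ∷ J) (suc k) k∉J = ≡.cong (_ ∷_) (inc-squarefree J k (k∉J ∘ Vec.there))

inc-squarefree-⊝ : ∀ {n} (J : Subset n) i → i Subset.∈ J → inc i (squarefree (J ⊝ i)) ≡ squarefree J
inc-squarefree-⊝ J i i∈J = ≡.trans (inc-squarefree (J ⊝ i) i (x∉p⊝x J i))
  (≡.cong squarefree (≡.trans (Vec.[]≔-idempotent J i)
    (≡.trans (≡.cong (J [ i ]≔_) (≡.sym (Vec.[]=⇒lookup i∈J))) (Vec.[]≔-lookup J i))))

inc-comm : ∀ {n} j k (e : Vec ℕ n) → inc j (inc k e) ≡ inc k (inc j e)
inc-comm zero    zero    (a ∷ e) = ≡.refl
inc-comm zero    (suc k) (a ∷ e) = ≡.refl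
inc-comm (suc j) zero    (a ∷ e) = ≡.refl
inc-comm (suc j) (suc k) (a ∷ e) = ≡.cong (a ∷_) (inc-comm j k e)

sum-inc : ∀ {n} j (e : Vec ℕ n) → Vec.sum (inc j e) ≡ suc (Vec.sum e)
sum-inc zero    (a ∷ e) = ≡.refl
sum-inc (suc j) (a ∷ e) = ≡.trans (≡.cong (a ℕ.+_) (sum-inc j e)) (ℕ.+-suc a _)

-- The case split behind induction on the degree: a monomial is 1 or is divisible by a variable.
data IncView {n} : Vec ℕ n → Set where
  zeros : IncView (Vec.replicate n 0)
  incs  : ∀ k e → IncView (inc k e)

incView : ∀ {n} (e : Vec ℕ n) → IncView e
incView []          = zeros
incView (suc a ∷ e) = incs zero (a ∷ e)
incView (zero  ∷ e) with incView e
... | zeros    = zeros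
... | incs k e = incs (suc k) (0 ∷ e)

squarefree-⊥ : ∀ n → squarefree (Subset.⊥ {n}) ≡ Vec.replicate n 0
squarefree-⊥ n = Vec.map-replicate _ outside n

-- The relations on linear forms, and regularity of every principal submatrix.

module _ {c ℓ : Level} (R : CommutativeRing c ℓ) where
  open CommutativeRing R hiding (zero)
  open Over R using (Matrix; detRC; elems; principalMinor)
  open Arithmetic R using (_∙_)
  open LinearSystem R

  Relations : ∀ {n} → Matrix n → (Vec ℕ n → Carrier) → Set ℓ
  Relations M f = ∀ i e → M i ∙ (λ j → f (inc j (inc i e))) ≈ 0#

  elems-unique : ∀ {n} (J : Subset n) → Unique (elems J)
  elems-unique {n} J = Unique.filter⁺ (Subset._∈? J) (Unique.allFin⁺ n)

  elems-tail : ∀ {n} (J : Subset n) {r L} → elems J ≡ r ∷ L → elems (J ⊝ r) ≡ L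
  elems-tail {n} J {r} = filter-tail (Subset._∈? J) (Subset._∈? (J ⊝ r)) (List.allFin n) (Unique.allFin⁺ n)
    (x∉p⊝x J r) (λ {i} i≢r → Vec.[]≔-minimal J i r i≢r) ∈-⊝⁻

  ∈-elems⁺ : ∀ {n} {J : Subset n} {i} → i Subset.∈ J → i ∈ elems J
  ∈-elems⁺ {J = J} {i} i∈J = List.∈-filter⁺ (Subset._∈? J) (List.∈-allFin i) i∈J

  ∈-elems⁻ : ∀ {n} {J : Subset n} {i} → i ∈ elems J → i Subset.∈ J
  ∈-elems⁻ {n} {J} = proj₂ ∘ List.∈-filter⁻ (Subset._∈? J) {xs = List.allFin n}

  -- The recursion removes the first element of `elems J`. The tail is `elems` of a smaller subset,
  -- so every determinant met on the way is a principal minor.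
  regular : IsField R → ∀ {n} (M : Matrix n) → (∀ J → Nonempty J → ¬ (principalMinor M J ≈ 0#)) →
            ∀ J → Regular M (elems J)
  regular isField M minors≉0 J = proj₁ (regular² (elems J) J ≡.refl)
    where
    regular² : ∀ L J → elems J ≡ L → Regular M L × Regular (flip M) L
    regular² []      J eq = regular-[] , regular-[]
    regular² (r ∷ L) J eq = regular²-∷ isField
      (Unique.Unique[x∷xs]⇒x∉xs (≡.subst Unique eq (elems-unique J)))
      (≡.subst (λ L → ¬ (detRC M L L ≈ 0#)) eq
        (minors≉0 J (r , ∈-elems⁻ (≡.subst (r ∈_) (≡.sym eq) (here ≡.refl)))))
      (regular² L (J ⊝ r) (elems-tail J eq))

-- Commuting operators and the extension of forms from squarefree monomials.

module Operators {c ℓ : Level} (R : CommutativeRing c ℓ) {n : ℕ} (M : Over.Matrix R n)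
  (regular : ∀ J → LinearSystem.Regular R M (Over.elems R J)) where
  open CommutativeRing R hiding (zero) renaming (Carrier to K)
  open Over R using (elems)
  open Arithmetic R
  open LinearSystem R
  open Relation.Binary.Reasoning.Setoid setoid
  open Algebra.Properties.Ring ring using (-1*x≈-x)

  solutions-unique : ∀ J {g h : Fin n → K} → (∀ {l} → l Subset.∉ J → g l ≈ h l) →
    (∀ {i} → i Subset.∈ J → M i ∙ g ≈ 0#) → (∀ {i} → i Subset.∈ J → M i ∙ h ≈ 0#) → ∀ l → g l ≈ h l
  solutions-unique J {g} {h} g≈h Mg≈0 Mh≈0 l = x-y≈0⇒x≈y (trans (+-congˡ (sym (-1*x≈-x (h l)))) (trivial _ off system l))
    where
    open Regular (regular J)
    off : Agree (elems J) (λ l → g l + - 1# * h l) (λ _ → 0#)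
    off {l} l∉ = trans (+-cong (g≈h (l∉ ∘ ∈-elems⁺ R)) (-1*x≈-x (h l))) (-‿inverseʳ (h l))
    system : Solves M (elems J) (λ l → g l + - 1# * h l)
    system {i} i∈ = begin
      M i ∙ (λ l → g l + - 1# * h l)  ≈⟨ ∙-linearʳ (M i) g h (- 1#) ⟩
      M i ∙ g + - 1# * M i ∙ h        ≈⟨ +-cong (Mg≈0 (∈-elems⁻ R i∈)) (*-congˡ (Mh≈0 (∈-elems⁻ R i∈))) ⟩
      0# + - 1# * 0#                  ≈⟨ trans (+-identityˡ _) (zeroʳ _) ⟩
      0#                              ∎

  -- The transpose of multiplication by the k-th variable in the quotient
  -- of K[y] by the forms yᵢ (Mᵢ · y), with the squarefree monomials as basis.
  T : Fin n → (Subset n → K) → Subset n → K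
  T k φ J = Regular.solution (regular J) (λ l → φ (J ⊕ l)) k

  T-∉ : ∀ {k} φ {J} → k Subset.∉ J → T k φ J ≈ φ (J ⊕ k)
  T-∉ φ {J} k∉J = Regular.agrees (regular J) _ (k∉J ∘ ∈-elems⁻ R)

  T-∈ : ∀ φ {J i} → i Subset.∈ J → M i ∙ (λ l → T l φ J) ≈ 0#
  T-∈ φ {J} i∈J = Regular.solves (regular J) _ (∈-elems⁺ R i∈J)

  T-unique : ∀ φ J {g : Fin n → K} → (∀ {l} → l Subset.∉ J → g l ≈ φ (J ⊕ l)) →
    (∀ {i} → i Subset.∈ J → M i ∙ g ≈ 0#) → ∀ l → T l φ J ≈ g l
  T-unique φ J g≈φ Mg≈0 = solutions-unique J (λ l∉J → trans (T-∉ φ l∉J) (sym (g≈φ l∉J))) (T-∈ φ) Mg≈0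

  -- `solution` is a bare function that is not assumed to respect equality of its argument, so
  -- congruence has to come from uniqueness.
  T-cong : ∀ k {φ ψ} → (∀ J → φ J ≈ ψ J) → ∀ J → T k φ J ≈ T k ψ J
  T-cong k {φ} {ψ} φ≈ψ J = T-unique φ J (λ {l} l∉J → trans (T-∉ ψ l∉J) (sym (φ≈ψ (J ⊕ l)))) (T-∈ ψ) k

  -- In the quotient this reads y_k (y_l y_J) = y_l y_{J ∪ k}. As functions of `l` both sides solve
  -- the system on `J`, since the equations on `J ⊕ k` include those on `J`.
  T-T-∉ : ∀ {k} l φ {J} → k Subset.∉ J → T l (T k φ) J ≈ T l φ (J ⊕ k)
  T-T-∉ {k} l φ {J} k∉J = T-unique (T k φ) J off (λ i∈J → T-∈ φ (∈-⊕⁺ i∈J)) l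
    where
    off : ∀ {l} → l Subset.∉ J → T l φ (J ⊕ k) ≈ T k φ (J ⊕ l)
    off {l} l∉J with l Fin.≟ k
    ... | yes ≡.refl = refl
    ... | no  l≢k    = begin
      T l φ (J ⊕ k)  ≈⟨ T-∉ φ (l∉J ∘ ∈-[]≔⁻ {s = inside} l≢k) ⟩
      φ (J ⊕ k ⊕ l)  ≡⟨ ≡.cong φ (Vec.[]≔-commutes J k l (l≢k ∘ ≡.sym)) ⟩
      φ (J ⊕ l ⊕ k)  ≈⟨ T-∉ φ (k∉J ∘ ∈-[]≔⁻ {s = inside} (l≢k ∘ ≡.sym)) ⟨
      T k φ (J ⊕ l)  ∎

  T-comm-∉ : ∀ {k} l φ {J} → k Subset.∉ J → T l (T k φ) J ≈ T k (T l φ) J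
  T-comm-∉ {k} l φ k∉J = trans (T-T-∉ l φ k∉J) (sym (T-∉ (T l φ) k∉J))

  -- For `k` outside `J` this is row `i` of the system on `J ⊕ k`. As a function of `k` the sum also
  -- satisfies the equations on `J`, by exchanging the two summations, so uniqueness extends the
  -- vanishing to all `k`.
  T-T-row : ∀ k φ {J i} → i Subset.∈ J → M i ∙ (λ l → T k (T l φ) J) ≈ 0#
  T-T-row k φ {J} {i} i∈J = solutions-unique J {λ k → M i ∙ (λ l → T k (T l φ) J)} {λ _ → 0#}
    (λ {k} k∉J → trans (∙-congʳ (M i) (λ l → T-∉ (T l φ) k∉J)) (T-∈ φ (∈-⊕⁺ i∈J)))
    (λ {j} j∈J → begin
      M j ∙ (λ k → M i ∙ (λ l → T k (T l φ) J))  ≈⟨ ∙-congʳ (M j) (λ k → ∙-comm (M i) _) ⟩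
      M j ∙ (λ k → (λ l → T k (T l φ) J) ∙ M i)  ≈⟨ ∙-swap (M j) (λ k l → T k (T l φ) J) (M i) ⟩
      M i ∙ (λ l → M j ∙ (λ k → T k (T l φ) J))  ≈⟨ ∙-zeroʳ (M i) _ (λ l → T-∈ (T l φ) j∈J) ⟩
      0#                                         ∎)
    (λ {j} _ → ∙-zeroʳ (M j) _ (λ _ → refl)) k

  T-comm : ∀ k l φ J → T k (T l φ) J ≈ T l (T k φ) J
  T-comm k l φ J with k Subset.∈? J
  ... | no  k∉J = sym (T-comm-∉ l φ k∉J)
  -- As a function of `l`, `T k (T l φ) J` solves the system that defines `T l (T k φ) J`: the
  -- values off `J` come from the case already settled with the indices exchanged, the equations
  -- from `T-T-row`.
  ... | yes k∈J = sym (T-unique (T k φ) J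
    (λ {l} l∉J → trans (T-comm-∉ k φ l∉J) (T-∉ (T k φ) l∉J)) (T-T-row k φ) l)

  iter : Fin n → ℕ → (Subset n → K) → Subset n → K
  iter k zero    φ = φ
  iter k (suc a) φ = T k (iter k a φ)

  iter-cong : ∀ k a {φ ψ} → (∀ J → φ J ≈ ψ J) → ∀ J → iter k a φ J ≈ iter k a ψ J
  iter-cong k zero    φ≈ψ = φ≈ψ
  iter-cong k (suc a) φ≈ψ = T-cong k (iter-cong k a φ≈ψ)

  iter-T : ∀ k a l φ J → iter k a (T l φ) J ≈ T l (iter k a φ) J
  iter-T k zero    l φ J = refl
  iter-T k (suc a) l φ J = trans (T-cong k (iter-T k a l φ) J) (T-comm k l (iter k a φ) J)

  -- `ι` names the variables belonging to the remaining exponents, which lets the recursion run over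
  -- tails of the exponent vector. In the end `ι` is `id`.
  pow : ∀ {m} → (Fin m → Fin n) → Vec ℕ m → (Subset n → K) → Subset n → K
  pow ι []      φ = φ
  pow ι (a ∷ e) φ = iter (ι zero) a (pow (ι ∘ suc) e φ)

  -- `pow` applies the operators in a fixed order. Commutation is what brings an extra factor from
  -- the middle to the front.
  pow-inc : ∀ {m} (ι : Fin m → Fin n) j e φ J → pow ι (inc j e) φ J ≈ T (ι j) (pow ι e φ) J
  pow-inc ι zero    (a ∷ e) φ J = refl
  pow-inc ι (suc j) (a ∷ e) φ J = begin
    iter (ι zero) a (pow (ι ∘ suc) (inc j e) φ) J          ≈⟨ iter-cong (ι zero) a (pow-inc (ι ∘ suc) j e φ) J ⟩
    iter (ι zero) a (T (ι (suc j)) (pow (ι ∘ suc) e φ)) J  ≈⟨ iter-T (ι zero) a (ι (suc j)) _ J ⟩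
    T (ι (suc j)) (pow ι (a ∷ e) φ) J                      ∎

  -- Homogeneity of degree `d` after `m` operators have been applied: each operator trades one
  -- element of the subset for one unit of `m`.
  Supported : ℕ → ℕ → (Subset n → K) → Set ℓ
  Supported d m φ = ∀ J → m ℕ.+ ∣ J ∣ ≢ d → φ J ≈ 0#

  -- Off the support all prescribed values `φ (J ⊕ l)` vanish, so zero solves the system and is its
  -- only solution.
  T-supported : ∀ {d m} k {φ} → Supported d m φ → Supported d (suc m) (T k φ)
  T-supported {d} {m} k {φ} φ≈0 J ≢d = T-unique φ J
    (λ {l} l∉J → sym (φ≈0 (J ⊕ l) λ ≡d → ≢d (≡.trans (≡.sym (ℕ.+-suc m ∣ J ∣))
      (≡.trans (≡.cong (m ℕ.+_) (≡.sym (∣p⊕x∣ J l l∉J))) ≡d))))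
    (λ {i} _ → ∙-zeroʳ (M i) _ (λ _ → refl)) k

  iter-supported : ∀ {d m} k a {φ} → Supported d m φ → Supported d (a ℕ.+ m) (iter k a φ)
  iter-supported k zero    φ≈0 = φ≈0
  iter-supported k (suc a) φ≈0 = T-supported k (iter-supported k a φ≈0)

  pow-supported : ∀ {m d} (ι : Fin m → Fin n) e {φ} → Supported d 0 φ → Supported d (Vec.sum e) (pow ι e φ)
  pow-supported ι []      φ≈0 = φ≈0
  pow-supported ι (a ∷ e) φ≈0 = iter-supported (ι zero) a (pow-supported (ι ∘ suc) e φ≈0)

  -- The union of `S` with the image of `J` under `ι`, built in the order in which the operators of
  -- `pow ι (squarefree J)` adjoin elements to `S`.
  join : ∀ {m} → (Fin m → Fin n) → Subset m → Subset n → Subset n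
  join ι []            S = S
  join ι (outside ∷ J) S = join (ι ∘ suc) J S
  join ι (inside  ∷ J) S = join (ι ∘ suc) J (S ⊕ ι zero)

  pow-squarefree : ∀ {m} (ι : Fin m → Fin n) → (∀ {i j} → ι i ≡ ι j → i ≡ j) →
    ∀ J φ S → (∀ j → ι j Subset.∉ S) → pow ι (squarefree J) φ S ≈ φ (join ι J S)
  pow-squarefree ι inj []            φ S ι∉S = refl
  pow-squarefree ι inj (outside ∷ J) φ S ι∉S =
    pow-squarefree (ι ∘ suc) (Fin.suc-injective ∘ inj) J φ S (ι∉S ∘ suc)
  pow-squarefree ι inj (inside  ∷ J) φ S ι∉S = trans (T-∉ (pow (ι ∘ suc) (squarefree J) φ) (ι∉S zero))
    (pow-squarefree (ι ∘ suc) (Fin.suc-injective ∘ inj) J φ (S ⊕ ι zero)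
      (λ j → ι∉S (suc j) ∘ ∈-[]≔⁻ {s = inside} (λ eq → Fin.0≢1+n (≡.sym (inj eq)))))

  join-∉ : ∀ {m} (ι : Fin m → Fin n) J S {x} → (∀ j → ι j ≢ x) → lookup (join ι J S) x ≡ lookup S x
  join-∉ ι []            S ι≢x = ≡.refl
  join-∉ ι (outside ∷ J) S ι≢x = join-∉ (ι ∘ suc) J S (ι≢x ∘ suc)
  join-∉ ι (inside  ∷ J) S ι≢x = ≡.trans (join-∉ (ι ∘ suc) J (S ⊕ ι zero) (ι≢x ∘ suc))
    (Vec.lookup∘update′ (ι≢x zero ∘ ≡.sym) S inside)

  join-∈ : ∀ {m} (ι : Fin m → Fin n) → (∀ {i j} → ι i ≡ ι j → i ≡ j) → ∀ J S →
    (∀ j → lookup S (ι j) ≡ outside) → ∀ j → lookup (join ι J S) (ι j) ≡ lookup J j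
  join-∈ ι inj (outside ∷ J) S S≡out zero =
    ≡.trans (join-∉ (ι ∘ suc) J S (λ j eq → Fin.0≢1+n (≡.sym (inj eq)))) (S≡out zero)
  join-∈ ι inj (inside  ∷ J) S S≡out zero =
    ≡.trans (join-∉ (ι ∘ suc) J (S ⊕ ι zero) (λ j eq → Fin.0≢1+n (≡.sym (inj eq)))) (Vec.lookup∘update (ι zero) S inside)
  join-∈ ι inj (outside ∷ J) S S≡out (suc j) = join-∈ (ι ∘ suc) (Fin.suc-injective ∘ inj) J S (S≡out ∘ suc) j
  join-∈ ι inj (inside  ∷ J) S S≡out (suc j) = join-∈ (ι ∘ suc) (Fin.suc-injective ∘ inj) J (S ⊕ ι zero)
    (λ j → ≡.trans (Vec.lookup∘update′ (λ eq → Fin.0≢1+n (≡.sym (inj eq))) S inside) (S≡out (suc j))) j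

  join-⊥ : ∀ J → join id J Subset.⊥ ≡ J
  join-⊥ J = ≡.trans (≡.sym (Vec.tabulate∘lookup _)) (≡.trans
    (Vec.tabulate-cong (join-∈ id id J Subset.⊥ (λ j → Vec.lookup-replicate j outside))) (Vec.tabulate∘lookup J))

  -- The extension of `φ` to all monomials: its value on y^e times the class of 1, which is y_J for
  -- the empty `J`.
  moment : (Subset n → K) → Vec ℕ n → K
  moment φ e = pow id e φ Subset.⊥

  moment-squarefree : ∀ φ J → moment φ (squarefree J) ≈ φ J
  moment-squarefree φ J = trans (pow-squarefree id id J φ Subset.⊥ (λ _ → Subset.∉⊥)) (reflexive (≡.cong φ (join-⊥ J)))

  moment-supported : ∀ {d φ} → Supported d 0 φ → ∀ e → Vec.sum e ≢ d → moment φ e ≈ 0#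
  moment-supported φ≈0 e ≢d = pow-supported id e φ≈0 Subset.⊥
    λ ≡d → ≢d (≡.trans (≡.sym (≡.trans (≡.cong (Vec.sum e ℕ.+_) (Subset.∣⊥∣≡0 n)) (ℕ.+-identityʳ _))) ≡d)

  -- The factor y_i is absorbed into the empty subset. What remains is row `i` of the system on the
  -- singleton of `i`.
  moment-relations : ∀ φ → Relations R M (moment φ)
  moment-relations φ i e = begin
    M i ∙ (λ j → moment φ (inc j (inc i e)))    ≈⟨ ∙-congʳ (M i) step ⟩
    M i ∙ (λ j → T j ψ (Subset.⊥ ⊕ i))          ≈⟨ T-∈ ψ (x∈p⊕x Subset.⊥ i) ⟩
    0#                                          ∎
    where
    ψ = pow id e φ
    step : ∀ j → moment φ (inc j (inc i e)) ≈ T j ψ (Subset.⊥ ⊕ i)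
    step j = begin
      pow id (inc j (inc i e)) φ Subset.⊥   ≈⟨ pow-inc id j (inc i e) φ Subset.⊥ ⟩
      T j (pow id (inc i e) φ) Subset.⊥     ≈⟨ T-cong j (pow-inc id i e φ) Subset.⊥ ⟩
      T j (T i ψ) Subset.⊥                  ≈⟨ T-T-∉ j ψ Subset.∉⊥ ⟩
      T j ψ (Subset.⊥ ⊕ i)                  ∎

  -- The hypotheses on f are inherited by f ∘ inc k, so induct on the degree of e.
  relations-vanish : ∀ m f → Relations R M f → (∀ J → f (squarefree J) ≈ 0#) → ∀ e → Vec.sum e ≡ m → f e ≈ 0#
  relations-vanish m f rel f≈0 e deg with incView e
  relations-vanish m f rel f≈0 _ deg | zeros = trans (reflexive (≡.cong f (≡.sym (squarefree-⊥ n)))) (f≈0 Subset.⊥)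
  relations-vanish zero f rel f≈0 _ deg | incs k e = contradiction (≡.trans (≡.sym (sum-inc k e)) deg) λ ()
  relations-vanish (suc m) f rel f≈0 _ deg | incs k e = relations-vanish m (f ∘ inc k)
    (λ i e → trans (∙-congʳ (M i) (λ j → reflexive (≡.cong f (≡.trans (inc-comm k j _) (≡.cong (inc j) (inc-comm k i e)))))) (rel i (inc k e)))
    shifted e (ℕ.suc-injective (≡.trans (≡.sym (sum-inc k e)) deg))
    where
    -- For fixed `J`, the values on y_k y_J as `k` varies solve the system on `J`: row `i` is the
    -- relation at the exponent of `J ⊝ i`. They vanish for `k` outside `J`, hence for all `k`.
    shifted : ∀ J → f (inc k (squarefree J)) ≈ 0#
    shifted J = solutions-unique J {λ k → f (inc k (squarefree J))} {λ _ → 0#}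
      (λ {l} l∉J → trans (reflexive (≡.cong f (inc-squarefree J l l∉J))) (f≈0 (J ⊕ l)))
      (λ {i} i∈J → trans (∙-congʳ (M i) (λ j → reflexive (≡.cong (f ∘ inc j) (≡.sym (inc-squarefree-⊝ J i i∈J))))) (rel i (squarefree (J ⊝ i))))
      (λ {i} _ → ∙-zeroʳ (M i) _ (λ _ → refl)) k

-- Lowering exponents, and assembling a vector one variable at a time.

dec : ∀ {n} → Fin n → Vec ℕ n → Vec ℕ n
dec j e = updateAt e j (_∸ 1)

dec-inc : ∀ {n} j (e : Vec ℕ n) → dec j (inc j e) ≡ e
dec-inc j e = ≡.trans (Vec.updateAt-updateAt j e) (Vec.updateAt-id-local j e ≡.refl)

inc-dec : ∀ {n} j (e : Vec ℕ n) {a} → lookup e j ≡ suc a → inc j (dec j e) ≡ e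
inc-dec j e eq = ≡.trans (Vec.updateAt-updateAt j e)
  (Vec.updateAt-id-local j e (≡.trans (≡.cong (λ a → suc (a ∸ 1)) eq) (≡.sym eq)))

lookup-inc : ∀ {n} j (e : Vec ℕ n) → lookup (inc j e) j ≡ suc (lookup e j)
lookup-inc j e = Vec.lookup∘updateAt j e

addAt : ∀ {n} → ℕ → Fin n → Vec ℕ n → Vec ℕ n
addAt zero    j m = m
addAt (suc a) j m = inc j (addAt a j m)

lookup-addAt : ∀ {n} a j (m : Vec ℕ n) → lookup (addAt a j m) j ≡ a ℕ.+ lookup m j
lookup-addAt zero    j m = ≡.refl
lookup-addAt (suc a) j m = ≡.trans (lookup-inc j (addAt a j m)) (≡.cong suc (lookup-addAt a j m))

lookup-addAt-≢ : ∀ {n} a {i j} (m : Vec ℕ n) → i ≢ j → lookup (addAt a j m) i ≡ lookup m i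
lookup-addAt-≢ zero    m i≢j = ≡.refl
lookup-addAt-≢ (suc a) {i} {j} m i≢j = ≡.trans (Vec.lookup∘updateAt′ i j i≢j (addAt a j m)) (lookup-addAt-≢ a m i≢j)

-- Follows the `foldr` in `shiftMono`, so that a partial product of shifted factors can be compared
-- with the monomial of its exponents.
collect : ∀ {n} → Vec ℕ n → List (Fin n) → Vec ℕ n
collect e = List.foldr (λ j → addAt (lookup e j) j) (Vec.replicate _ 0)

lookup-collect-∉ : ∀ {n} (e : Vec ℕ n) js {i} → i ∉ js → lookup (collect e js) i ≡ 0
lookup-collect-∉ e []       {i} i∉js = Vec.lookup-replicate i 0
lookup-collect-∉ e (j ∷ js) {i} i∉js =
  ≡.trans (lookup-addAt-≢ (lookup e j) (collect e js) (i∉js ∘ here)) (lookup-collect-∉ e js (i∉js ∘ there))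

lookup-collect : ∀ {n} (e : Vec ℕ n) js → Unique js → ∀ {i} → i ∈ js → lookup (collect e js) i ≡ lookup e i
lookup-collect e (j ∷ js) uniq@(_ ∷ _) (here ≡.refl) = ≡.trans (lookup-addAt (lookup e j) j (collect e js))
  (≡.trans (≡.cong (lookup e j ℕ.+_) (lookup-collect-∉ e js (Unique.Unique[x∷xs]⇒x∉xs uniq))) (ℕ.+-identityʳ _))
lookup-collect e (j ∷ js) (j∉js ∷ uniq) (there i∈js) = ≡.trans
  (lookup-addAt-≢ (lookup e j) (collect e js) (λ i≡j → All.lookup j∉js i∈js (≡.sym i≡j)))
  (lookup-collect e js uniq i∈js)

collect-allFin : ∀ {n} (e : Vec ℕ n) → collect e (List.allFin n) ≡ e
collect-allFin {n} e = ≡.trans (≡.sym (Vec.tabulate∘lookup _)) (≡.trans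
  (Vec.tabulate-cong (λ i → lookup-collect e (List.allFin n) (Unique.allFin⁺ n) (List.∈-allFin i))) (Vec.tabulate∘lookup e))

-- Polynomial operations on coefficient functions.

module Coefficients {c ℓ : Level} (R : CommutativeRing c ℓ) where
  open CommutativeRing R hiding (zero) renaming (Carrier to K)
  open Over R
  open Arithmetic R
  open Solver using (solve; _:=_; _:+_; _:*_; con)
  open Relation.Binary.Reasoning.Setoid setoid
  open Algebra.Properties.Ring ring using (-1*x≈-x; -0#≈0#)

  δ : ∀ {n} → Mono n → Mono n → K
  δ f e with Vec.≡-dec ℕ._≟_ f e
  ... | yes _ = 1#
  ... | no  _ = 0#

  δ-≡ : ∀ {n} {f e : Mono n} → f ≡ e → δ f e ≈ 1#
  δ-≡ {f = f} {e} f≡e with Vec.≡-dec ℕ._≟_ f e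
  ... | yes _   = refl
  ... | no  f≢e = contradiction f≡e f≢e

  δ-≢ : ∀ {n} {f e : Mono n} → f ≢ e → δ f e ≈ 0#
  δ-≢ {f = f} {e} f≢e with Vec.≡-dec ℕ._≟_ f e
  ... | yes f≡e = contradiction f≡e f≢e
  ... | no  _   = refl

  δ-⇔ : ∀ {m n} {f e : Mono m} {g h : Mono n} → (f ≡ e → g ≡ h) → (g ≡ h → f ≡ e) → δ f e ≈ δ g h
  δ-⇔ {f = f} {e} {g} {h} to from with Vec.≡-dec ℕ._≟_ f e
  ... | yes f≡e = sym (δ-≡ (to f≡e))
  ... | no  f≢e = sym (δ-≢ (f≢e ∘ from))

  -- The linear functional with value `w f` at the monomial `f`. Coefficient extraction is the case
  -- where `w` is a `δ`, so identities between products reduce to identities between weights,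
  -- however often a monomial is listed.
  pairing : ∀ {n} → (Mono n → K) → Poly n → K
  pairing w []            = 0#
  pairing w ((a , f) ∷ p) = a * w f + pairing w p

  coeff-pairing : ∀ {n} (p : Poly n) e → coeff p e ≈ pairing (λ f → δ f e) p
  coeff-pairing []            e = refl
  coeff-pairing ((a , f) ∷ p) e with Vec.≡-dec ℕ._≟_ f e
  ... | yes _ = +-cong (sym (*-identityʳ a)) (coeff-pairing p e)
  ... | no  _ = trans (coeff-pairing p e) (trans (sym (+-identityˡ _)) (+-congʳ (sym (zeroʳ a))))

  coeff-∷ : ∀ {n} a f (p : Poly n) e → coeff ((a , f) ∷ p) e ≈ a * δ f e + coeff p e
  coeff-∷ a f p e = trans (coeff-pairing ((a , f) ∷ p) e) (+-congˡ (sym (coeff-pairing p e)))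

  pairing-cong : ∀ {n} {w w′ : Mono n → K} → (∀ f → w f ≈ w′ f) → ∀ p → pairing w p ≈ pairing w′ p
  pairing-cong w≈w′ []            = refl
  pairing-cong w≈w′ ((a , f) ∷ p) = +-cong (*-congˡ (w≈w′ f)) (pairing-cong w≈w′ p)

  pairing-zero : ∀ {n} {w : Mono n → K} → (∀ f → w f ≈ 0#) → ∀ p → pairing w p ≈ 0#
  pairing-zero w≈0 []            = refl
  pairing-zero w≈0 ((a , f) ∷ p) =
    trans (+-cong (trans (*-congˡ (w≈0 f)) (zeroʳ a)) (pairing-zero w≈0 p)) (+-identityˡ 0#)

  pairing-++ : ∀ {n} (w : Mono n → K) p q → pairing w (p ++ q) ≈ pairing w p + pairing w q
  pairing-++ w []            q = sym (+-identityˡ _)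
  pairing-++ w ((a , f) ∷ p) q = trans (+-congˡ (pairing-++ w p q)) (sym (+-assoc _ _ _))

  pairing-map : ∀ {m n} (w : Mono n → K) a (φ : Mono m → Mono n) p →
    pairing w (List.map (λ { (b , f) → a * b , φ f }) p) ≈ a * pairing (w ∘ φ) p
  pairing-map w a φ []            = sym (zeroʳ a)
  pairing-map w a φ ((b , f) ∷ p) = begin
    a * b * w (φ f) + pairing w (List.map _ p)     ≈⟨ +-congˡ (pairing-map w a φ p) ⟩
    a * b * w (φ f) + a * pairing (w ∘ φ) p        ≈⟨ solve 4 (λ a b w x → a :* b :* w :+ a :* x := a :* (b :* w :+ x)) refl a b _ _ ⟩
    a * (b * w (φ f) + pairing (w ∘ φ) p)          ∎

  infixl 6 _⊞_
  _⊞_ : ∀ {n} → Mono n → Mono n → Mono n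
  _⊞_ = Vec.zipWith ℕ._+_

  pairing-* : ∀ {n} (w : Mono n → K) p q → pairing w (p *ₚ q) ≈ pairing (λ f → pairing (λ g → w (f ⊞ g)) q) p
  pairing-* w []            q = refl
  pairing-* w ((a , f) ∷ p) q = begin
    pairing w (List.map _ q ++ p *ₚ q)              ≈⟨ pairing-++ w (List.map _ q) (p *ₚ q) ⟩
    pairing w (List.map _ q) + pairing w (p *ₚ q)   ≈⟨ +-cong (pairing-map w a (f ⊞_) q) (pairing-* w p q) ⟩
    pairing _ ((a , f) ∷ p)                         ∎

  pairing-*-assoc : ∀ {n} (w : Mono n → K) p q r → pairing w ((p *ₚ q) *ₚ r) ≈ pairing w (p *ₚ (q *ₚ r))
  pairing-*-assoc w p q r = begin
    pairing w ((p *ₚ q) *ₚ r)                                                              ≈⟨ pairing-* w (p *ₚ q) r ⟩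
    pairing (λ f → pairing (λ h → w (f ⊞ h)) r) (p *ₚ q)                                   ≈⟨ pairing-* _ p q ⟩
    pairing (λ f → pairing (λ g → pairing (λ h → w (f ⊞ g ⊞ h)) r) q) p
      ≈⟨ pairing-cong (λ f → pairing-cong (λ g → pairing-cong (λ h → reflexive (≡.cong w (Vec.zipWith-assoc ℕ.+-assoc f g h))) r) q) p ⟩
    pairing (λ f → pairing (λ g → pairing (λ h → w (f ⊞ (g ⊞ h))) r) q) p                  ≈⟨ pairing-cong (λ f → pairing-* (λ g → w (f ⊞ g)) q r) p ⟨
    pairing (λ f → pairing (λ g → w (f ⊞ g)) (q *ₚ r)) p                                   ≈⟨ pairing-* w p (q *ₚ r) ⟨
    pairing w (p *ₚ (q *ₚ r))                                                              ∎

  coeff-+ : ∀ {n} (p q : Poly n) e → coeff (p +ₚ q) e ≈ coeff p e + coeff q e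
  coeff-+ p q e = trans (coeff-pairing (p ++ q) e)
    (trans (pairing-++ _ p q) (+-cong (sym (coeff-pairing p e)) (sym (coeff-pairing q e))))

  coeff-· : ∀ {n} a (p : Poly n) e → coeff (a ·ₚ p) e ≈ a * coeff p e
  coeff-· a p e = trans (coeff-pairing (a ·ₚ p) e)
    (trans (pairing-map _ a id p) (*-congˡ (sym (coeff-pairing p e))))

  coeff-- : ∀ {n} (p q : Poly n) e → coeff (p -ₚ q) e ≈ coeff p e - coeff q e
  coeff-- p q e = trans (coeff-+ p (-ₚ q) e) (+-congˡ (trans (coeff-· (- 1#) q e) (-1*x≈-x _)))

  derivative : ∀ {n} → Fin n → (Mono n → K) → Mono n → K
  derivative i c e = fromℕ (suc (lookup e i)) * c (inc i e)

  coeff-∂ : ∀ {n} i (p : Poly n) e → coeff (∂ i p) e ≈ derivative i (coeff p) e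
  coeff-∂ i []            e = sym (zeroʳ _)
  coeff-∂ i ((a , f) ∷ p) e = begin
    coeff (∂ i ((a , f) ∷ p)) e                                    ≈⟨ coeff-∷ (fromℕ (lookup f i) * a) (dec i f) (∂ i p) e ⟩
    fromℕ (lookup f i) * a * δ (dec i f) e + coeff (∂ i p) e       ≈⟨ +-cong (term (Vec.≡-dec ℕ._≟_ f (inc i e))) (coeff-∂ i p e) ⟩
    k * (a * δ f (inc i e)) + k * coeff p (inc i e)                ≈⟨ distribˡ k _ _ ⟨
    k * (a * δ f (inc i e) + coeff p (inc i e))                    ≈⟨ *-congˡ (coeff-∷ a f p (inc i e)) ⟨
    derivative i (coeff ((a , f) ∷ p)) e                           ∎
    where
    k = fromℕ (suc (lookup e i))
    -- If the exponent of `x_i` is zero, the truncated `dec i` leaves `f` unchanged and may give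
    -- `e`. The term then vanishes because of its factor `fromℕ 0`.
    zeroterm : ∀ m → lookup f i ≡ m → f ≢ inc i e → fromℕ m * a * δ (dec i f) e ≈ 0#
    zeroterm zero    eq f≢ = trans (*-congʳ (zeroˡ a)) (zeroˡ _)
    zeroterm (suc m) eq f≢ = trans (*-congˡ (δ-≢ λ dec≡e → f≢ (≡.trans (≡.sym (inc-dec i f eq)) (≡.cong (inc i) dec≡e)))) (zeroʳ _)
    term : Dec (f ≡ inc i e) → fromℕ (lookup f i) * a * δ (dec i f) e ≈ k * (a * δ f (inc i e))
    term (yes ≡.refl) = begin
      fromℕ (lookup f i) * a * δ (dec i f) e  ≈⟨ *-cong (*-congʳ (reflexive (≡.cong fromℕ (lookup-inc i e)))) (δ-≡ (dec-inc i e)) ⟩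
      k * a * 1#                              ≈⟨ *-assoc k a 1# ⟩
      k * (a * 1#)                            ≈⟨ *-congˡ (*-congˡ (δ-≡ {f = f} ≡.refl)) ⟨
      k * (a * δ f (inc i e))                 ∎
    term (no f≢) = begin
      fromℕ (lookup f i) * a * δ (dec i f) e  ≈⟨ zeroterm _ ≡.refl f≢ ⟩
      0#                                      ≈⟨ solve 2 (λ k a → con (+ 0) := k :* (a :* con (+ 0))) refl k a ⟩
      k * (a * 0#)                            ≈⟨ *-congˡ (*-congˡ (δ-≢ f≢)) ⟨
      k * (a * δ f (inc i e))                 ∎

  -- Guards the truncated subtraction in `dec`: at an exponent without the variable there is no
  -- coefficient to read. Being a function of a number, it commutes with ring operations without a
  -- case split on exponents.
  gate : ℕ → K → K
  gate zero    x = 0#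
  gate (suc _) x = x

  gate-cong : ∀ m {x y} → x ≈ y → gate m x ≈ gate m y
  gate-cong zero    x≈y = refl
  gate-cong (suc m) x≈y = x≈y

  gate-+ : ∀ m x y → gate m (x + y) ≈ gate m x + gate m y
  gate-+ zero    x y = sym (+-identityˡ 0#)
  gate-+ (suc m) x y = refl

  gate-* : ∀ m a x → gate m (a * x) ≈ a * gate m x
  gate-* zero    a x = sym (zeroʳ a)
  gate-* (suc m) a x = refl

  gate-neg : ∀ m x → gate m (- x) ≈ - gate m x
  gate-neg zero    x = sym -0#≈0#
  gate-neg (suc m) x = refl

  -- Multiplication by the j-th variable.
  X : ∀ {n} → Fin n → (Mono n → K) → Mono n → K
  X j c e = gate (lookup e j) (c (dec j e))

  δ-inc : ∀ {n} j (f e : Mono n) → δ (inc j f) e ≈ X j (δ f) e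
  δ-inc j f e with lookup e j in eq
  ... | zero  = δ-≢ {f = inc j f} λ { ≡.refl → ℕ.0≢1+n (≡.trans (≡.sym eq) (lookup-inc j f)) }
  ... | suc a = δ-⇔ {f = inc j f} (λ inc≡e → ≡.trans (≡.sym (dec-inc j f)) (≡.cong (dec j) inc≡e))
                    (λ f≡dec → ≡.trans (≡.cong (inc j) f≡dec) (inc-dec j e eq))

  pairing-inc : ∀ {n} j (p : Poly n) e → pairing (λ f → δ (inc j f) e) p ≈ X j (coeff p) e
  pairing-inc j p e = trans (pairing-cong (λ f → δ-inc j f e) p) (gated (lookup e j))
    where
    gated : ∀ m → pairing (λ f → gate m (δ f (dec j e))) p ≈ gate m (coeff p (dec j e))
    gated zero    = pairing-zero (λ _ → refl) p
    gated (suc m) = sym (coeff-pairing p (dec j e))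

  -- Multiplication by `x_j - v_j`, the linear factor of a shifted monomial.
  Y : ∀ {n} → (Fin n → K) → Fin n → (Mono n → K) → Mono n → K
  Y v j c e = X j c e - v j * c e

  coeff-linear-* : ∀ {n} (v : Fin n → K) j (p : Poly n) e → coeff ((var j -ₚ const (v j)) *ₚ p) e ≈ Y v j (coeff p) e
  coeff-linear-* {n} v j p e = begin
    coeff ((var j -ₚ const (v j)) *ₚ p) e
      ≈⟨ coeff-pairing ((var j -ₚ const (v j)) *ₚ p) e ⟩
    pairing (λ f → δ f e) ((var j -ₚ const (v j)) *ₚ p)
      ≈⟨ pairing-* _ (var j -ₚ const (v j)) p ⟩
    1# * pairing (λ g → δ (updateAt 𝟎 j (λ _ → 1) ⊞ g) e) p + ((- 1# * v j) * pairing (λ g → δ (𝟎 ⊞ g) e) p + 0#)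
      ≈⟨ +-cong (*-congˡ (pairing-cong (λ g → reflexive (≡.cong (λ f → δ f e) (unit j g))) p))
                (+-congʳ (*-congˡ (pairing-cong (λ g → reflexive (≡.cong (λ f → δ f e) (Vec.zipWith-identityˡ ℕ.+-identityˡ g))) p))) ⟩
    1# * pairing (λ g → δ (inc j g) e) p + ((- 1# * v j) * pairing (λ g → δ g e) p + 0#)
      ≈⟨ +-cong (*-congˡ (pairing-inc j p e)) (+-congʳ (*-congˡ (sym (coeff-pairing p e)))) ⟩
    1# * X j (coeff p) e + ((- 1# * v j) * coeff p e + 0#)
      ≈⟨ +-cong (*-identityˡ _) (trans (+-identityʳ _) (trans (*-assoc _ _ _) (-1*x≈-x _))) ⟩
    Y v j (coeff p) e ∎
    where
    𝟎 = Vec.replicate n 0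
    unit : ∀ {m} (j : Fin m) g → updateAt (Vec.replicate m 0) j (λ _ → 1) ⊞ g ≡ inc j g
    unit zero    (b ∷ g) = ≡.cong (suc b ∷_) (Vec.zipWith-identityˡ ℕ.+-identityˡ g)
    unit (suc j) (b ∷ g) = ≡.cong (b ∷_) (unit j g)

  coeff-const-* : ∀ {n} (p : Poly n) e → coeff (const 1# *ₚ p) e ≈ coeff p e
  coeff-const-* {n} p e = begin
    coeff (const 1# *ₚ p) e                                   ≈⟨ coeff-pairing (const 1# *ₚ p) e ⟩
    pairing (λ f → δ f e) (const 1# *ₚ p)                     ≈⟨ pairing-* _ (const 1#) p ⟩
    1# * pairing (λ g → δ (Vec.replicate n 0 ⊞ g) e) p + 0#   ≈⟨ trans (+-identityʳ _) (*-identityˡ _) ⟩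
    pairing (λ g → δ (Vec.replicate n 0 ⊞ g) e) p             ≈⟨ pairing-cong (λ g → reflexive (≡.cong (λ f → δ f e) (Vec.zipWith-identityˡ ℕ.+-identityˡ g))) p ⟩
    pairing (λ g → δ g e) p                                   ≈⟨ coeff-pairing p e ⟨
    coeff p e                                                 ∎

  -- `^ₚ` groups a power before it meets the remaining product, so peeling off one linear factor
  -- requires regrouping.
  coeff-*-assoc : ∀ {n} (p q r : Poly n) e → coeff ((p *ₚ q) *ₚ r) e ≈ coeff (p *ₚ (q *ₚ r)) e
  coeff-*-assoc p q r e = trans (coeff-pairing ((p *ₚ q) *ₚ r) e)
    (trans (pairing-*-assoc _ p q r) (sym (coeff-pairing (p *ₚ (q *ₚ r)) e)))

-- The directional derivative and its commutator with the variables.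

module Calculus {c ℓ : Level} (R : CommutativeRing c ℓ) {n : ℕ} (v : Fin n → CommutativeRing.Carrier R) where
  open CommutativeRing R hiding (zero) renaming (Carrier to K)
  open Over R
  open Arithmetic R
  open LinearSystem R using (indicator; indicator-≡; indicator-≢)
  open Coefficients R
  open Solver using (solve; _:=_; _:+_; _:*_; _:-_; :-_; con)
  open Relation.Binary.Reasoning.Setoid setoid
  open Algebra.Properties.Ring ring using (-0#≈0#)

  D : (Mono n → K) → Mono n → K
  D c e = v ∙ (λ j → derivative j c e)

  derivative-cong : ∀ i {c c′ : Mono n → K} → (∀ e → c e ≈ c′ e) → ∀ e → derivative i c e ≈ derivative i c′ e
  derivative-cong i c≈c′ e = *-congˡ (c≈c′ (inc i e))

  derivative-linear : ∀ i a (c c′ : Mono n → K) e →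
    derivative i (λ e → a * c e + c′ e) e ≈ derivative i c′ e + a * derivative i c e
  derivative-linear i a c c′ e = solve 4 (λ k a x y → k :* (a :* x :+ y) := k :* y :+ a :* (k :* x)) refl _ a _ _

  derivative-comm : ∀ i j (c : Mono n → K) e → derivative i (derivative j c) e ≈ derivative j (derivative i c) e
  derivative-comm i j c e with i Fin.≟ j
  ... | yes ≡.refl = refl
  ... | no  i≢j    = begin
    fromℕ (suc (lookup e i)) * (fromℕ (suc (lookup (inc i e) j)) * c (inc j (inc i e)))
      ≡⟨ ≡.cong₂ (λ m f → fromℕ (suc (lookup e i)) * (fromℕ (suc m) * c f)) (Vec.lookup∘updateAt′ j i (i≢j ∘ ≡.sym) e) (inc-comm j i e) ⟩
    fromℕ (suc (lookup e i)) * (fromℕ (suc (lookup e j)) * c (inc i (inc j e)))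
      ≈⟨ solve 3 (λ x y z → x :* (y :* z) := y :* (x :* z)) refl _ _ _ ⟩
    fromℕ (suc (lookup e j)) * (fromℕ (suc (lookup e i)) * c (inc i (inc j e)))
      ≡⟨ ≡.cong (λ m → fromℕ (suc (lookup e j)) * (fromℕ (suc m) * c (inc i (inc j e)))) (Vec.lookup∘updateAt′ i j i≢j e) ⟨
    fromℕ (suc (lookup e j)) * (fromℕ (suc (lookup (inc j e) i)) * c (inc i (inc j e))) ∎

  D-cong : ∀ {c c′} → (∀ e → c e ≈ c′ e) → ∀ e → D c e ≈ D c′ e
  D-cong c≈c′ e = ∙-congʳ v (λ j → derivative-cong j c≈c′ e)

  D-linear : ∀ a c c′ e → D (λ e → a * c e + c′ e) e ≈ a * D c e + D c′ e
  D-linear a c c′ e = begin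
    D (λ e → a * c e + c′ e) e                                  ≈⟨ ∙-congʳ v (λ j → derivative-linear j a c c′ e) ⟩
    v ∙ (λ j → derivative j c′ e + a * derivative j c e)        ≈⟨ ∙-linearʳ v _ _ a ⟩
    D c′ e + a * D c e                                          ≈⟨ +-comm _ _ ⟩
    a * D c e + D c′ e                                          ∎

  D-zero : ∀ {c} → (∀ e → c e ≈ 0#) → ∀ e → D c e ≈ 0#
  D-zero c≈0 e = ∙-zeroʳ v _ (λ j → trans (*-congˡ (c≈0 (inc j e))) (zeroʳ _))

  D-scale : ∀ a c e → D (λ e → - (a * c e)) e ≈ - (a * D c e)
  D-scale a c e = begin
    D (λ e → - (a * c e)) e               ≈⟨ D-cong (λ e → solve 2 (λ a x → :- (a :* x) := :- a :* x :+ con (+ 0)) refl a (c e)) e ⟩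
    D (λ e → - a * c e + 0#) e            ≈⟨ D-linear (- a) c (λ _ → 0#) e ⟩
    - a * D c e + D (λ _ → 0#) e          ≈⟨ +-congˡ (D-zero (λ _ → refl) e) ⟩
    - a * D c e + 0#                      ≈⟨ solve 2 (λ a x → :- a :* x :+ con (+ 0) := :- (a :* x)) refl a (D c e) ⟩
    - (a * D c e)                         ∎

  derivative-D : ∀ i c e → derivative i (D c) e ≈ D (derivative i c) e
  derivative-D i c e = begin
    k * v ∙ (λ j → derivative j c (inc i e))            ≈⟨ ∙-scaleʳ v _ k ⟨
    v ∙ (λ j → derivative i (derivative j c) e)         ≈⟨ ∙-congʳ v (λ j → derivative-comm i j c e) ⟩
    D (derivative i c) e                                ∎
    where k = fromℕ (suc (lookup e i))

  -- The Weyl relation: the commutator of ∂_k with x_j is 1 for `k = j` and 0 otherwise.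
  derivative-X : ∀ k j c (e : Mono n) → derivative k (X j c) e ≈ X j (derivative k c) e + c e * indicator j k
  derivative-X k j c e with k Fin.≟ j
  ... | yes ≡.refl = begin
    fromℕ (suc (lookup e k)) * gate (lookup (inc k e) k) (c (dec k (inc k e)))
      ≡⟨ ≡.cong₂ (λ m f → fromℕ (suc (lookup e k)) * gate m (c f)) (lookup-inc k e) (dec-inc k e) ⟩
    fromℕ (suc (lookup e k)) * c e
      ≈⟨ onDiagonal (lookup e k) ≡.refl ⟩
    X k (derivative k c) e + c e * 1# ∎
    where
    -- Of the factor `suc m`, the part `m` comes from x_k ∂_k and the remaining 1 from the
    -- commutator. For `m = 0` the gate is closed and only the commutator is left.
    onDiagonal : ∀ m → lookup e k ≡ m → (1# + fromℕ m) * c e ≈ gate m (derivative k c (dec k e)) + c e * 1#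
    onDiagonal zero    eq = trans (*-congʳ (+-identityʳ 1#)) (trans (*-comm 1# (c e)) (sym (+-identityˡ _)))
    onDiagonal (suc m) eq = begin
      (1# + fromℕ (suc m)) * c e                   ≈⟨ distribʳ (c e) 1# (fromℕ (suc m)) ⟩
      1# * c e + fromℕ (suc m) * c e               ≈⟨ trans (+-comm _ _) (+-congˡ (*-comm 1# (c e))) ⟩
      fromℕ (suc m) * c e + c e * 1#
        ≡⟨ ≡.cong₂ (λ a f → fromℕ (suc a) * c f + c e * 1#) (≡.trans (≡.cong (_∸ 1) (≡.sym eq)) (≡.sym (Vec.lookup∘updateAt k e))) (≡.sym (inc-dec k e eq)) ⟩
      derivative k c (dec k e) + c e * 1#          ∎
  ... | no k≢j = begin
    fromℕ (suc (lookup e k)) * gate (lookup (inc k e) j) (c (dec j (inc k e)))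
      ≡⟨ ≡.cong₂ (λ m f → fromℕ (suc (lookup e k)) * gate m (c f)) (Vec.lookup∘updateAt′ j k (k≢j ∘ ≡.sym) e) (Vec.updateAt-commutes j k (k≢j ∘ ≡.sym) e) ⟩
    fromℕ (suc (lookup e k)) * gate (lookup e j) (c (inc k (dec j e)))
      ≈⟨ gate-* (lookup e j) _ _ ⟨
    gate (lookup e j) (fromℕ (suc (lookup e k)) * c (inc k (dec j e)))
      ≡⟨ ≡.cong (λ m → gate (lookup e j) (fromℕ (suc m) * c (inc k (dec j e)))) (Vec.lookup∘updateAt′ k j k≢j e) ⟨
    X j (derivative k c) e
      ≈⟨ trans (sym (+-identityʳ _)) (+-congˡ (sym (zeroʳ (c e)))) ⟩
    X j (derivative k c) e + c e * 0# ∎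

  -- The commutator is the constant `v j`, which is why exp(-D) carries x_j to x_j - v_j.
  D-X : ∀ j c e → D (X j c) e ≈ X j (D c) e + v j * c e
  D-X j c e = begin
    D (X j c) e                                                      ≈⟨ ∙-congʳ v (λ k → derivative-X k j c e) ⟩
    v ∙ (λ k → X j (derivative k c) e + c e * indicator j k)         ≈⟨ ∙-linearʳ v _ (indicator j) (c e) ⟩
    v ∙ (λ k → X j (derivative k c) e) + c e * v ∙ indicator j       ≈⟨ +-cong (gated (lookup e j)) (*-congˡ v∙indicator) ⟩
    X j (D c) e + c e * v j                                          ≈⟨ +-congˡ (*-comm _ _) ⟩
    X j (D c) e + v j * c e                                          ∎
    where
    gated : ∀ m {w} → v ∙ (λ k → gate m (w k)) ≈ gate m (v ∙ w)
    gated zero    = ∙-zeroʳ v _ (λ _ → refl)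
    gated (suc m) = refl
    v∙indicator : v ∙ indicator j ≈ v j
    v∙indicator = trans (sum-single _ j (λ k k≢j → trans (*-congˡ (indicator-≢ k≢j)) (zeroʳ _)))
      (trans (*-congˡ (indicator-≡ j)) (*-identityʳ _))

  -- The new `D` goes innermost, so that the nilpotency hypothesis for `c` at `suc m` is by
  -- definition the one for `D c` at `m`.
  iterate-D : ℕ → (Mono n → K) → Mono n → K
  iterate-D zero    c = c
  iterate-D (suc m) c = iterate-D m (D c)

  -- Coefficient functions have no finiteness of their own. This strict degree bound supplies it,
  -- and each `D` lowers it by one.
  Below : ℕ → (Mono n → K) → Set ℓ
  Below B c = ∀ e → B ≤ deg e → c e ≈ 0#

  derivative-Below : ∀ {B} i {c} → Below B c → Below B (derivative i c)
  derivative-Below i c≈0 e B≤ = trans (*-congˡ (c≈0 (inc i e) (ℕ.≤-trans B≤ (ℕ.≤-trans (ℕ.n≤1+n _) (ℕ.≤-reflexive (≡.sym (sum-inc i e))))))) (zeroʳ _)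

  D-Below : ∀ {B c} → Below (suc B) c → Below B (D c)
  D-Below c≈0 e B≤ = ∙-zeroʳ v _ (λ j → trans (*-congˡ (c≈0 (inc j e) (ℕ.≤-trans (s≤s B≤) (ℕ.≤-reflexive (≡.sym (sum-inc j e)))))) (zeroʳ _))

  D-nilpotent : ∀ B {c} → Below B c → ∀ e → iterate-D B c e ≈ 0#
  D-nilpotent zero    c≈0 e = c≈0 e z≤n
  D-nilpotent (suc B) c≈0   = D-nilpotent B (D-Below c≈0)

  -- Taylor's formula: the shift as a truncated exponential.

  module Exponential (isField : IsField R) (char0 : CharZero) where
    open IsField isField

    inv : ℕ → K
    inv k = proj₁ (inverse (fromℕ (suc k)) (char0 k))

    inv-inverse : ∀ k → fromℕ (suc k) * inv k ≈ 1#
    inv-inverse k = proj₂ (inverse (fromℕ (suc k)) (char0 k))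

    -- E k = (-D)ᵏ / k!
    E : ℕ → (Mono n → K) → Mono n → K
    E zero    c   = c
    E (suc k) c e = - (inv k * D (E k c) e)

    E-cong : ∀ k {c c′} → (∀ e → c e ≈ c′ e) → ∀ e → E k c e ≈ E k c′ e
    E-cong zero    c≈c′   = c≈c′
    E-cong (suc k) c≈c′ e = -‿cong (*-congˡ (D-cong (E-cong k c≈c′) e))

    E-linear : ∀ k a c c′ e → E k (λ e → a * c e + c′ e) e ≈ a * E k c e + E k c′ e
    E-linear zero    a c c′ e = refl
    E-linear (suc k) a c c′ e = begin
      - (inv k * D (E k (λ e → a * c e + c′ e)) e)           ≈⟨ -‿cong (*-congˡ (D-cong (E-linear k a c c′) e)) ⟩
      - (inv k * D (λ e → a * E k c e + E k c′ e) e)         ≈⟨ -‿cong (*-congˡ (D-linear a (E k c) (E k c′) e)) ⟩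
      - (inv k * (a * D (E k c) e + D (E k c′) e))           ≈⟨ solve 4 (λ i a x y → :- (i :* (a :* x :+ y)) := a :* :- (i :* x) :+ :- (i :* y)) refl (inv k) a _ _ ⟩
      a * E (suc k) c e + E (suc k) c′ e                     ∎

    E-D : ∀ k c e → E k (D c) e ≈ D (E k c) e
    E-D zero    c e = refl
    E-D (suc k) c e = begin
      - (inv k * D (E k (D c)) e)         ≈⟨ -‿cong (*-congˡ (D-cong (E-D k c) e)) ⟩
      - (inv k * D (D (E k c)) e)         ≈⟨ D-scale (inv k) (D (E k c)) e ⟨
      D (E (suc k) c) e                   ∎

    E-derivative : ∀ k i c e → derivative i (E k c) e ≈ E k (derivative i c) e
    E-derivative zero    i c e = refl
    E-derivative (suc k) i c e = begin
      fromℕ (suc (lookup e i)) * - (inv k * D (E k c) (inc i e))  ≈⟨ solve 3 (λ m a x → m :* :- (a :* x) := :- (a :* (m :* x))) refl _ (inv k) _ ⟩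
      - (inv k * derivative i (D (E k c)) e)                      ≈⟨ -‿cong (*-congˡ (derivative-D i (E k c) e)) ⟩
      - (inv k * D (derivative i (E k c)) e)                      ≈⟨ -‿cong (*-congˡ (D-cong (E-derivative k i c) e)) ⟩
      - (inv k * D (E k (derivative i c)) e)                      ∎

    E-zero : ∀ k {c} → (∀ e → D c e ≈ 0#) → ∀ e → E (suc k) c e ≈ 0#
    E-zero k {c} Dc≈0 e = trans (-‿cong (trans (*-congˡ (trans (sym (E-D k c e)) (vanish k e))) (zeroʳ _))) -0#≈0#
      where
      vanish : ∀ k e → E k (D c) e ≈ 0#
      vanish zero    = Dc≈0
      vanish (suc k) e = trans (-‿cong (trans (*-congˡ (D-zero (vanish k) e)) (zeroʳ _))) -0#≈0#

    D-E : ∀ k c e → D (E k c) e ≈ - (fromℕ (suc k) * E (suc k) c e)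
    D-E k c e = begin
      D (E k c) e                                         ≈⟨ *-identityˡ _ ⟨
      1# * D (E k c) e                                    ≈⟨ *-congʳ (inv-inverse k) ⟨
      fromℕ (suc k) * inv k * D (E k c) e                 ≈⟨ solve 3 (λ m i x → m :* i :* x := :- (m :* :- (i :* x))) refl (fromℕ (suc k)) (inv k) _ ⟩
      - (fromℕ (suc k) * - (inv k * D (E k c) e))         ∎

    X-E : ∀ k j c e → X j (E (suc k) c) e ≈ - (inv k * X j (D (E k c)) e)
    X-E k j c e = trans (gate-neg (lookup e j) _) (-‿cong (gate-* (lookup e j) (inv k) _))

    -- The coefficient of t^(k+1) in exp(-tD) x_j = (x_j - t v_j) exp(-tD).
    E-X : ∀ k j c e → E (suc k) (X j c) e ≈ X j (E (suc k) c) e - v j * E k c e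
    E-X zero j c e = begin
      - (i * D (X j c) e)                      ≈⟨ -‿cong (*-congˡ (D-X j c e)) ⟩
      - (i * (X j (D c) e + v j * c e))        ≈⟨ solve 4 (λ i x v y → :- (i :* (x :+ v :* y)) := :- (i :* x) :- v :* (con (+ 1) :* i :* y)) refl i _ (v j) (c e) ⟩
      - (i * X j (D c) e) - v j * (fromℕ 1 * i * c e)  ≈⟨ +-cong (sym (X-E 0 j c e)) (-‿cong (*-congˡ (trans (*-congʳ (inv-inverse 0)) (*-identityˡ _)))) ⟩
      X j (E 1 c) e - v j * c e                ∎
      where i = inv 0
    E-X (suc k) j c e = begin
      - (i * D (E (suc k) (X j c)) e)
        ≈⟨ -‿cong (*-congˡ (D-cong (λ e → trans (E-X k j c e) (solve 3 (λ x v y → x :- v :* y := :- v :* y :+ x) refl _ (v j) _)) e)) ⟩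
      - (i * D (λ e → - v j * E k c e + X j (E (suc k) c) e) e)
        ≈⟨ -‿cong (*-congˡ (D-linear (- v j) (E k c) (X j (E (suc k) c)) e)) ⟩
      - (i * (- v j * D (E k c) e + D (X j (E (suc k) c)) e))
        ≈⟨ -‿cong (*-congˡ (+-cong (*-congˡ (D-E k c e)) (D-X j (E (suc k) c) e))) ⟩
      -- The two commutator contributions, `suc k` from `D-E` and 1 from `D-X`, add up to the
      -- integer that `inv (suc k)` cancels.
      - (i * (- v j * - (fromℕ (suc k) * E (suc k) c e) + (X j (D (E (suc k) c)) e + v j * E (suc k) c e)))
        ≈⟨ solve 5 (λ i v m y x → :- (i :* (:- v :* :- (m :* y) :+ (x :+ v :* y))) := :- (i :* x) :- v :* ((con (+ 1) :+ m) :* i :* y)) refl i (v j) (fromℕ (suc k)) _ _ ⟩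
      - (i * X j (D (E (suc k) c)) e) - v j * ((fromℕ 1 + fromℕ (suc k)) * i * E (suc k) c e)
        ≈⟨ +-cong (sym (X-E (suc k) j c e)) (-‿cong (*-congˡ (trans (*-congʳ (trans (*-congʳ (+-congʳ (+-identityʳ 1#))) (inv-inverse (suc k)))) (*-identityˡ _)))) ⟩
      X j (E (suc (suc k)) c) e - v j * E (suc k) c e ∎
      where i = inv (suc k)

    Taylor : ℕ → (Mono n → K) → Mono n → K
    Taylor zero    c e = c e
    Taylor (suc N) c e = Taylor N c e + E (suc N) c e

    Taylor-cong : ∀ N {c c′} → (∀ e → c e ≈ c′ e) → ∀ e → Taylor N c e ≈ Taylor N c′ e
    Taylor-cong zero    c≈c′ e = c≈c′ e
    Taylor-cong (suc N) c≈c′ e = +-cong (Taylor-cong N c≈c′ e) (E-cong (suc N) c≈c′ e)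

    Taylor-linear : ∀ N a c c′ e → Taylor N (λ e → a * c e + c′ e) e ≈ a * Taylor N c e + Taylor N c′ e
    Taylor-linear zero    a c c′ e = refl
    Taylor-linear (suc N) a c c′ e = trans (+-cong (Taylor-linear N a c c′ e) (E-linear (suc N) a c c′ e))
      (solve 5 (λ a x y z w → (a :* x :+ y) :+ (a :* z :+ w) := a :* (x :+ z) :+ (y :+ w)) refl a _ _ _ _)

    Taylor-D : ∀ N c e → Taylor N (D c) e ≈ D (Taylor N c) e
    Taylor-D zero    c e = refl
    Taylor-D (suc N) c e = begin
      Taylor N (D c) e + E (suc N) (D c) e            ≈⟨ +-cong (Taylor-D N c e) (E-D (suc N) c e) ⟩
      D (Taylor N c) e + D (E (suc N) c) e            ≈⟨ +-congʳ (*-identityˡ _) ⟨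
      1# * D (Taylor N c) e + D (E (suc N) c) e       ≈⟨ D-linear 1# (Taylor N c) (E (suc N) c) e ⟨
      D (λ e → 1# * Taylor N c e + E (suc N) c e) e   ≈⟨ D-cong (λ e → +-congʳ {x = E (suc N) c e} (*-identityˡ (Taylor N c e))) e ⟩
      D (Taylor (suc N) c) e                          ∎

    Taylor-derivative : ∀ N i c e → derivative i (Taylor N c) e ≈ Taylor N (derivative i c) e
    Taylor-derivative zero    i c e = refl
    Taylor-derivative (suc N) i c e = trans (distribˡ _ _ _) (+-cong (Taylor-derivative N i c e) (E-derivative (suc N) i c e))

    Taylor-kernel : ∀ N {c} → (∀ e → D c e ≈ 0#) → ∀ e → Taylor N c e ≈ c e
    Taylor-kernel zero    Dc≈0 e = refl
    Taylor-kernel (suc N) Dc≈0 e = trans (+-cong (Taylor-kernel N Dc≈0 e) (E-zero N Dc≈0 e)) (+-identityʳ _)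

    Taylor-X : ∀ N j c e → Taylor (suc N) (X j c) e ≈ X j (Taylor (suc N) c) e - v j * Taylor N c e
    Taylor-X zero    j c e = begin
      X j c e + E 1 (X j c) e                         ≈⟨ +-congˡ (E-X 0 j c e) ⟩
      X j c e + (X j (E 1 c) e - v j * c e)           ≈⟨ +-assoc _ _ _ ⟨
      X j c e + X j (E 1 c) e - v j * c e             ≈⟨ +-congʳ (gate-+ (lookup e j) _ _) ⟨
      X j (Taylor 1 c) e - v j * c e                  ∎
    Taylor-X (suc N) j c e = begin
      Taylor (suc N) (X j c) e + E (suc (suc N)) (X j c) e
        ≈⟨ +-cong (Taylor-X N j c e) (E-X (suc N) j c e) ⟩
      (X j (Taylor (suc N) c) e - v j * Taylor N c e) + (X j (E (suc (suc N)) c) e - v j * E (suc N) c e)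
        ≈⟨ solve 5 (λ x v y z w → (x :- v :* y) :+ (z :- v :* w) := (x :+ z) :- v :* (y :+ w)) refl _ (v j) _ _ _ ⟩
      (X j (Taylor (suc N) c) e + X j (E (suc (suc N)) c) e) - v j * Taylor (suc N) c e
        ≈⟨ +-congʳ (gate-+ (lookup e j) _ _) ⟨
      X j (Taylor (suc (suc N)) c) e - v j * Taylor (suc N) c e ∎

    Taylor-step : ∀ N {c} → (∀ e → D (D c) e ≈ 0#) → ∀ e → Taylor (suc N) c e ≈ c e - D c e
    Taylor-step zero {c} DDc≈0 e = +-congˡ (-‿cong (trans (*-congʳ inv0≈1) (*-identityˡ _)))
      where
      inv0≈1 : inv 0 ≈ 1#
      inv0≈1 = trans (sym (trans (*-congʳ (+-identityʳ 1#)) (*-identityˡ _))) (inv-inverse 0)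
    Taylor-step (suc N) {c} DDc≈0 e = trans (+-cong (Taylor-step N DDc≈0 e) E≈0) (+-identityʳ _)
      where
      E≈0 : E (suc (suc N)) c e ≈ 0#
      E≈0 = begin
        - (inv (suc N) * D (E (suc N) c) e)  ≈⟨ -‿cong (*-congˡ (E-D (suc N) c e)) ⟨
        - (inv (suc N) * E (suc N) (D c) e)  ≈⟨ -‿cong (*-congˡ (E-zero N DDc≈0 e)) ⟩
        - (inv (suc N) * 0#)                 ≈⟨ trans (-‿cong (zeroʳ _)) -0#≈0# ⟩
        0#                                   ∎

    -- With `c` also `D c` is fixed, and it needs one application of `D` fewer to vanish, so D (D c)
    -- = 0 by induction. The series for `c` then stops at c - D c. The order is `suc N` because
    -- `Taylor 0` fixes everything.
    Taylor-fixed : ∀ N m c → (∀ e → iterate-D m c e ≈ 0#) → (∀ e → Taylor (suc N) c e ≈ c e) → ∀ e → D c e ≈ 0#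
    Taylor-fixed N zero    c c≈0 fixed = D-zero c≈0
    Taylor-fixed N (suc m) c DDc≈0 fixed e = begin
      D c e                     ≈⟨ solve 2 (λ x y → y := x :- (x :- y)) refl (c e) (D c e) ⟩
      c e - (c e - D c e)       ≈⟨ +-congˡ (-‿cong (Taylor-step N D²c≈0 e)) ⟨
      c e - Taylor (suc N) c e  ≈⟨ +-congˡ (-‿cong (fixed e)) ⟩
      c e - c e                 ≈⟨ -‿inverseʳ _ ⟩
      0#                        ∎
      where
      D²c≈0 : ∀ e → D (D c) e ≈ 0#
      D²c≈0 = Taylor-fixed N m (D c) DDc≈0 (λ e → trans (Taylor-D (suc N) c e) (D-cong fixed e))

    -- All N ≥ deg m at once, because Taylor-X lowers the order of truncation.
    IsTaylor : (Mono n → K) → Mono n → Set ℓ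
    IsTaylor c m = ∀ N → deg m ≤ N → ∀ e → c e ≈ Taylor N (δ m) e

    isTaylor-Y : ∀ {c m} j → IsTaylor c m → IsTaylor (Y v j c) (inc j m)
    isTaylor-Y {c} {m} j c≈ N deg≤N e with ≡.subst (_≤ N) (sum-inc j m) deg≤N
    ... | s≤s {n = N} deg≤ = begin
      X j c e - v j * c e                                               ≈⟨ +-cong (gate-cong (lookup e j) (c≈ (suc N) (ℕ.m≤n⇒m≤1+n deg≤) (dec j e))) (-‿cong (*-congˡ (c≈ N deg≤ e))) ⟩
      X j (Taylor (suc N) (δ m)) e - v j * Taylor N (δ m) e             ≈⟨ Taylor-X N j (δ m) e ⟨
      Taylor (suc N) (X j (δ m)) e                                      ≈⟨ Taylor-cong (suc N) (λ e → sym (δ-inc j m e)) e ⟩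
      Taylor (suc N) (δ (inc j m)) e                                    ∎

    factor : Fin n → Poly n
    factor j = var j -ₚ const (v j)

    isTaylor-power : ∀ a j {q m} → IsTaylor (coeff q) m → IsTaylor (coeff (factor j ^ₚ a *ₚ q)) (addAt a j m)
    isTaylor-power zero    j {q} q≈ N deg≤N e = trans (coeff-const-* q e) (q≈ N deg≤N e)
    isTaylor-power (suc a) j {q} {m} q≈ N deg≤N e = begin
      coeff ((factor j *ₚ factor j ^ₚ a) *ₚ q) e   ≈⟨ coeff-*-assoc (factor j) (factor j ^ₚ a) q e ⟩
      coeff (factor j *ₚ (factor j ^ₚ a *ₚ q)) e   ≈⟨ coeff-linear-* v j (factor j ^ₚ a *ₚ q) e ⟩
      Y v j (coeff (factor j ^ₚ a *ₚ q)) e         ≈⟨ isTaylor-Y {m = addAt a j m} j (isTaylor-power a j {q} {m} q≈) N deg≤N e ⟩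
      Taylor N (δ (addAt (suc a) j m)) e           ∎

    isTaylor-product : ∀ f js →
      IsTaylor (coeff (List.foldr _*ₚ_ (const 1#) (List.map (λ j → factor j ^ₚ lookup f j) js))) (collect f js)
    isTaylor-product f []       N _ e = begin
      coeff (const 1#) e                    ≈⟨ coeff-∷ 1# (Vec.replicate n 0) [] e ⟩
      1# * δ (Vec.replicate n 0) e + 0#     ≈⟨ trans (+-identityʳ _) (*-identityˡ _) ⟩
      δ (Vec.replicate n 0) e               ≈⟨ Taylor-kernel N (λ e → ∙-zeroʳ v _ (λ j → trans (*-congˡ (δ-≢ (zero≢inc j e))) (zeroʳ _))) e ⟨
      Taylor N (δ (Vec.replicate n 0)) e    ∎
      where
      zero≢inc : ∀ j e → Vec.replicate n 0 ≢ inc j e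
      zero≢inc j e eq = ℕ.0≢1+n (≡.trans (≡.sym (Vec.lookup-replicate j 0)) (≡.trans (≡.cong (λ f → lookup f j) eq) (lookup-inc j e)))
    isTaylor-product f (j ∷ js) = isTaylor-power (lookup f j) j (isTaylor-product f js)

    isTaylor-shiftMono : ∀ f → IsTaylor (coeff (shiftMono v f)) f
    isTaylor-shiftMono f = ≡.subst (IsTaylor (coeff (shiftMono v f))) (collect-allFin f) (isTaylor-product f (List.allFin n))

    -- Listed terms may cancel undetectably, so only an upper bound for the degree can be had. The
    -- sum of all listed degrees is the simplest one.
    bound : Poly n → ℕ
    bound []            = 0
    bound ((a , f) ∷ p) = deg f ℕ.+ bound p

    coeff-Below : ∀ p → Below (suc (bound p)) (coeff p)
    coeff-Below []            e B< = refl
    coeff-Below ((a , f) ∷ p) e B< = begin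
      coeff ((a , f) ∷ p) e      ≈⟨ coeff-∷ a f p e ⟩
      a * δ f e + coeff p e      ≈⟨ +-cong (trans (*-congˡ (δ-≢ f≢e)) (zeroʳ a)) (coeff-Below p e (ℕ.≤-trans (s≤s (ℕ.m≤n+m _ (deg f))) B<)) ⟩
      0# + 0#                    ≈⟨ +-identityˡ 0# ⟩
      0#                         ∎
      where
      f≢e : f ≢ e
      f≢e ≡.refl = ℕ.<-irrefl ≡.refl (ℕ.≤-trans (s≤s (ℕ.m≤m+n (deg f) (bound p))) B<)

    coeff-shift : ∀ N p → bound p ≤ N → ∀ e → coeff (shift v p) e ≈ Taylor N (coeff p) e
    coeff-shift N []            b≤N e = sym (Taylor-kernel N {λ _ → 0#} (D-zero (λ _ → refl)) e)
    coeff-shift N ((a , f) ∷ p) b≤N e = begin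
      coeff (a ·ₚ shiftMono v f +ₚ shift v p) e           ≈⟨ coeff-+ (a ·ₚ shiftMono v f) (shift v p) e ⟩
      coeff (a ·ₚ shiftMono v f) e + coeff (shift v p) e  ≈⟨ +-cong (trans (coeff-· a (shiftMono v f) e) (*-congˡ (isTaylor-shiftMono f N (ℕ.≤-trans (ℕ.m≤m+n _ _) b≤N) e)))
                                                                    (coeff-shift N p (ℕ.≤-trans (ℕ.m≤n+m _ (deg f)) b≤N) e) ⟩
      a * Taylor N (δ f) e + Taylor N (coeff p) e         ≈⟨ Taylor-linear N a (δ f) (coeff p) e ⟨
      Taylor N (λ e → a * δ f e + coeff p e) e            ≈⟨ Taylor-cong N (coeff-∷ a f p) e ⟨
      Taylor N (coeff ((a , f) ∷ p)) e                    ∎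

    coeff-∂-shift : ∀ i p e → coeff (∂ i (shift v p -ₚ p)) e ≈
      Taylor (suc (bound p)) (derivative i (coeff p)) e - derivative i (coeff p) e
    coeff-∂-shift i p e = begin
      coeff (∂ i (shift v p -ₚ p)) e                              ≈⟨ coeff-∂ i (shift v p -ₚ p) e ⟩
      k * coeff (shift v p -ₚ p) (inc i e)                        ≈⟨ *-congˡ (coeff-- (shift v p) p (inc i e)) ⟩
      k * (coeff (shift v p) (inc i e) - coeff p (inc i e))       ≈⟨ solve 3 (λ k x y → k :* (x :- y) := k :* x :- k :* y) refl k _ _ ⟩
      k * coeff (shift v p) (inc i e) - k * coeff p (inc i e)     ≈⟨ +-congʳ (*-congˡ (coeff-shift N p (ℕ.n≤1+n _) (inc i e))) ⟩
      derivative i (Taylor N (coeff p)) e - derivative i (coeff p) e    ≈⟨ +-congʳ (Taylor-derivative N i (coeff p) e) ⟩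
      Taylor N (derivative i (coeff p)) e - derivative i (coeff p) e    ∎
      where
      k = fromℕ (suc (lookup e i))
      -- Order `bound p` would already compute the shift. One more gives the successor that
      -- `Taylor-fixed` asks for.
      N = suc (bound p)

    ∂-shift⇒D : ∀ i p → ∂ i (shift v p -ₚ p) ≈ₚ 0ₚ → ∀ e → D (derivative i (coeff p)) e ≈ 0#
    ∂-shift⇒D i p ∂≈0 = Taylor-fixed (bound p) (suc (bound p)) (derivative i (coeff p))
      (D-nilpotent (suc (bound p)) (derivative-Below i (coeff-Below p)))
      (λ e → x-y≈0⇒x≈y (trans (sym (coeff-∂-shift i p e)) (∂≈0 e)))

    D⇒∂-shift : ∀ i p → (∀ e → D (derivative i (coeff p)) e ≈ 0#) → ∂ i (shift v p -ₚ p) ≈ₚ 0ₚ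
    D⇒∂-shift i p D≈0 e = trans (coeff-∂-shift i p e)
      (trans (+-congʳ (Taylor-kernel (suc (bound p)) D≈0 e)) (-‿inverseʳ _))

-- Enumerating subsets and monomials; multi-index factorials.

lookup-injective : ∀ {a} {A : Set a} {xs : List A} → Unique xs → ∀ i j → List.lookup xs i ≡ List.lookup xs j → i ≡ j
lookup-injective (x∉xs ∷ uniq) zero    zero    eq = ≡.refl
lookup-injective (x∉xs ∷ uniq) zero    (suc j) eq = contradiction eq (All.lookup x∉xs (List.∈-lookup j))
lookup-injective (x∉xs ∷ uniq) (suc i) zero    eq = contradiction (≡.sym eq) (All.lookup x∉xs (List.∈-lookup i))
lookup-injective (x∉xs ∷ uniq) (suc i) (suc j) eq = ≡.cong suc (lookup-injective uniq i j eq)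

ofSize : ∀ n → ℕ → List (Subset n)
ofSize zero    zero    = [] ∷ []
ofSize zero    (suc d) = []
ofSize (suc n) zero    = List.map (outside ∷_) (ofSize n zero)
ofSize (suc n) (suc d) = List.map (inside ∷_) (ofSize n d) ++ List.map (outside ∷_) (ofSize n (suc d))

subsets : ∀ n → List (Subset n)
subsets zero    = [] ∷ []
subsets (suc n) = List.map (inside ∷_) (subsets n) ++ List.map (outside ∷_) (subsets n)

length-map-++ : ∀ {a b} {A : Set a} {B : Set b} (f g : A → B) xs ys →
  length (List.map f xs ++ List.map g ys) ≡ length xs ℕ.+ length ys
length-map-++ f g xs ys = ≡.trans (List.length-++ (List.map f xs))
  (≡.cong₂ ℕ._+_ (List.length-map f xs) (List.length-map g ys))

length-ofSize : ∀ n d → length (ofSize n d) ≡ n C d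
length-ofSize zero    zero    = ≡.refl
length-ofSize zero    (suc d) = ≡.sym (k>n⇒nCk≡0 {0} {suc d} (s≤s z≤n))
length-ofSize (suc n) zero    = ≡.trans (List.length-map (outside ∷_) (ofSize n 0)) (≡.trans (length-ofSize n 0)
  (≡.trans (nC0≡1 n) (≡.sym (nC0≡1 (suc n)))))
  where
  nC0≡1 : ∀ n → n C 0 ≡ 1
  nC0≡1 n = ≡.trans (nCk≡nC[n∸k] {0} {n} z≤n) (nCn≡1 n)
length-ofSize (suc n) (suc d) = ≡.trans (length-map-++ (inside ∷_) (outside ∷_) (ofSize n d) (ofSize n (suc d)))
  (≡.trans (≡.cong₂ ℕ._+_ (length-ofSize n d) (length-ofSize n (suc d))) (nCk+nC[k+1]≡[n+1]C[k+1] n d))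

length-subsets : ∀ n → length (subsets n) ≡ 2 ^ n
length-subsets zero    = ≡.refl
length-subsets (suc n) = ≡.trans (length-map-++ (inside ∷_) (outside ∷_) (subsets n) (subsets n))
  (≡.trans (≡.cong (λ m → m ℕ.+ m) (length-subsets n)) (≡.cong (2 ^ n ℕ.+_) (≡.sym (ℕ.+-identityʳ (2 ^ n)))))

unique-map-++ : ∀ {n} {xs ys : List (Subset n)} → Unique xs → Unique ys →
  Unique (List.map (inside ∷_) xs ++ List.map (outside ∷_) ys)
unique-map-++ uxs uys = Unique.++⁺ (Unique.map⁺ Vec.∷-injectiveʳ uxs) (Unique.map⁺ Vec.∷-injectiveʳ uys) disjoint
  where
  disjoint : ∀ {v} → ¬ (v ∈ List.map (inside ∷_) _ × v ∈ List.map (outside ∷_) _)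
  disjoint (v∈ , v∈′) with List.∈-map⁻ (inside ∷_) v∈ | List.∈-map⁻ (outside ∷_) v∈′
  ... | _ , _ , ≡.refl | _ , _ , ()

unique-ofSize : ∀ n d → Unique (ofSize n d)
unique-ofSize zero    zero    = All.[] ∷ []
unique-ofSize zero    (suc d) = []
unique-ofSize (suc n) zero    = Unique.map⁺ Vec.∷-injectiveʳ (unique-ofSize n zero)
unique-ofSize (suc n) (suc d) = unique-map-++ (unique-ofSize n d) (unique-ofSize n (suc d))

unique-subsets : ∀ n → Unique (subsets n)
unique-subsets zero    = All.[] ∷ []
unique-subsets (suc n) = unique-map-++ (unique-subsets n) (unique-subsets n)

∈-subsets : ∀ {n} (J : Subset n) → J ∈ subsets n
∈-subsets []            = here ≡.refl
∈-subsets (inside  ∷ J) = List.∈-++⁺ˡ (List.∈-map⁺ (inside ∷_) (∈-subsets J))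
∈-subsets (outside ∷ J) = List.∈-++⁺ʳ _ (List.∈-map⁺ (outside ∷_) (∈-subsets J))

∈-ofSize⁺ : ∀ {n} (J : Subset n) → J ∈ ofSize n ∣ J ∣
∈-ofSize⁺ []            = here ≡.refl
∈-ofSize⁺ (inside  ∷ J) = List.∈-++⁺ˡ (List.∈-map⁺ (inside ∷_) (∈-ofSize⁺ J))
∈-ofSize⁺ (outside ∷ J) with ∣ J ∣ | ∈-ofSize⁺ J
... | zero  | J∈ = List.∈-map⁺ (outside ∷_) J∈
... | suc d | J∈ = List.∈-++⁺ʳ _ (List.∈-map⁺ (outside ∷_) J∈)

∈-ofSize⁻ : ∀ n d {J : Subset n} → J ∈ ofSize n d → ∣ J ∣ ≡ d
∈-ofSize⁻ zero    zero    (here ≡.refl) = ≡.refl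
∈-ofSize⁻ (suc n) zero    J∈ with List.∈-map⁻ (outside ∷_) J∈
... | _ , J′∈ , ≡.refl = ∈-ofSize⁻ n zero J′∈
∈-ofSize⁻ (suc n) (suc d) J∈ with List.∈-++⁻ (List.map (inside ∷_) (ofSize n d)) J∈
... | inj₁ J∈ˡ with List.∈-map⁻ (inside ∷_) J∈ˡ
...   | _ , J′∈ , ≡.refl = ≡.cong suc (∈-ofSize⁻ n d J′∈)
∈-ofSize⁻ (suc n) (suc d) J∈ | inj₂ J∈ʳ with List.∈-map⁻ (outside ∷_) J∈ʳ
...   | _ , J′∈ , ≡.refl = ∈-ofSize⁻ n (suc d) J′∈

-- Contains every exponent vector of degree at most `d`. The surplus is harmless, since the
-- coefficient functions listed over it vanish in the other degrees.
box : ∀ n → ℕ → List (Vec ℕ n)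
box zero    d = [] ∷ []
box (suc n) d = List.cartesianProductWith _∷_ (List.upTo (suc d)) (box n d)

unique-box : ∀ n d → Unique (box n d)
unique-box zero    d = All.[] ∷ []
unique-box (suc n) d = Unique.cartesianProductWith⁺ _∷_ Vec.∷-injective (Unique.upTo⁺ (suc d)) (unique-box n d)

∈-box : ∀ {n d} (e : Vec ℕ n) → Vec.sum e ≤ d → e ∈ box n d
∈-box []      sum≤d = here ≡.refl
∈-box (a ∷ e) sum≤d = List.∈-cartesianProductWith⁺ _∷_ (List.∈-upTo⁺ (s≤s (ℕ.≤-trans (ℕ.m≤m+n a _) sum≤d)))
  (∈-box e (ℕ.≤-trans (ℕ.m≤n+m _ a) sum≤d))

factorial : ∀ {n} → Vec ℕ n → ℕ
factorial []      = 1
factorial (a ∷ e) = a ! ℕ.* factorial e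

factorial-inc : ∀ {n} j (e : Vec ℕ n) → factorial (inc j e) ≡ suc (lookup e j) ℕ.* factorial e
factorial-inc zero    (a ∷ e) = ℕ.*-assoc (suc a) (a !) (factorial e)
factorial-inc (suc j) (a ∷ e) = ≡.trans (≡.cong (a ! ℕ.*_) (factorial-inc j e))
  (≡.trans (≡.sym (ℕ.*-assoc (a !) k (factorial e))) (≡.trans (≡.cong (ℕ._* factorial e) (ℕ.*-comm (a !) k)) (ℕ.*-assoc k (a !) (factorial e))))
  where k = suc (lookup e j)

factorial-nonZero : ∀ {n} (e : Vec ℕ n) → NonZero (factorial e)
factorial-nonZero []      = _
factorial-nonZero (a ∷ e) = ℕ.m*n≢0 (a !) (factorial e) ⦃ ℕ._!≢0 a ⦄ ⦃ factorial-nonZero e ⦄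

factorial-squarefree : ∀ {n} (J : Subset n) → factorial (squarefree J) ≡ 1
factorial-squarefree []            = ≡.refl
factorial-squarefree (outside ∷ J) = ≡.trans (ℕ.+-identityʳ _) (factorial-squarefree J)
factorial-squarefree (inside  ∷ J) = ≡.trans (ℕ.+-identityʳ _) (factorial-squarefree J)

sum-squarefree : ∀ {n} (J : Subset n) → Vec.sum (squarefree J) ≡ ∣ J ∣
sum-squarefree []            = ≡.refl
sum-squarefree (outside ∷ J) = sum-squarefree J
sum-squarefree (inside  ∷ J) = ≡.cong suc (sum-squarefree J)

-- Homogeneous components and polynomials with prescribed coefficients.

module _ {c ℓ : Level} (R : CommutativeRing c ℓ) where
  open CommutativeRing R hiding (zero) renaming (Carrier to K)
  open Over R
  open Arithmetic R
  open Coefficients R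
  open Relation.Binary.Reasoning.Setoid setoid

  component-accept : ∀ {n} d a f (p : Poly n) → deg f ≡ d → component d ((a , f) ∷ p) ≡ (a , f) ∷ component d p
  component-accept d a f p = List.filter-accept (λ t → deg (proj₂ t) ℕ.≟ d) {a , f} {p}

  component-reject : ∀ {n} d a f (p : Poly n) → deg f ≢ d → component d ((a , f) ∷ p) ≡ component d p
  component-reject d a f p = List.filter-reject (λ t → deg (proj₂ t) ℕ.≟ d) {a , f} {p}

  coeff-component-≡ : ∀ {n} d (p : Poly n) e → deg e ≡ d → coeff (component d p) e ≈ coeff p e
  coeff-component-≡ d []            e deg≡ = refl
  coeff-component-≡ d ((a , f) ∷ p) e deg≡ = case deg f ℕ.≟ d of λ where
    (yes f≡d) → begin
      coeff (component d ((a , f) ∷ p)) e    ≡⟨ ≡.cong (λ q → coeff q e) (component-accept d a f p f≡d) ⟩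
      coeff ((a , f) ∷ component d p) e      ≈⟨ coeff-∷ a f (component d p) e ⟩
      a * δ f e + coeff (component d p) e    ≈⟨ +-congˡ (coeff-component-≡ d p e deg≡) ⟩
      a * δ f e + coeff p e                  ≈⟨ coeff-∷ a f p e ⟨
      coeff ((a , f) ∷ p) e                  ∎
    (no f≢d) → begin
      coeff (component d ((a , f) ∷ p)) e    ≡⟨ ≡.cong (λ q → coeff q e) (component-reject d a f p f≢d) ⟩
      coeff (component d p) e                ≈⟨ coeff-component-≡ d p e deg≡ ⟩
      coeff p e                              ≈⟨ +-identityˡ _ ⟨
      0# + coeff p e                         ≈⟨ +-congʳ (trans (*-congˡ (δ-≢ {f = f} {e} λ f≡e → f≢d (≡.trans (≡.cong deg f≡e) deg≡))) (zeroʳ a)) ⟨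
      a * δ f e + coeff p e                  ≈⟨ coeff-∷ a f p e ⟨
      coeff ((a , f) ∷ p) e                  ∎

  coeff-component-≢ : ∀ {n} d (p : Poly n) e → deg e ≢ d → coeff (component d p) e ≈ 0#
  coeff-component-≢ d []            e deg≢ = refl
  coeff-component-≢ d ((a , f) ∷ p) e deg≢ = case deg f ℕ.≟ d of λ where
    (yes f≡d) → begin
      coeff (component d ((a , f) ∷ p)) e    ≡⟨ ≡.cong (λ q → coeff q e) (component-accept d a f p f≡d) ⟩
      coeff ((a , f) ∷ component d p) e      ≈⟨ coeff-∷ a f (component d p) e ⟩
      a * δ f e + coeff (component d p) e    ≈⟨ +-cong (trans (*-congˡ (δ-≢ {f = f} {e} λ f≡e → deg≢ (≡.trans (≡.cong deg (≡.sym f≡e)) f≡d))) (zeroʳ a)) (coeff-component-≢ d p e deg≢) ⟩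
      0# + 0#                                ≈⟨ +-identityˡ 0# ⟩
      0#                                     ∎
    (no f≢d) → trans (reflexive (≡.cong (λ q → coeff q e) (component-reject d a f p f≢d))) (coeff-component-≢ d p e deg≢)

  fromFunction : ∀ {n} → List (Mono n) → (Mono n → K) → Poly n
  fromFunction L c = List.map (λ e → c e , e) L

  coeff-fromFunction-∉ : ∀ {n} (L : List (Mono n)) c {e} → e ∉ L → coeff (fromFunction L c) e ≈ 0#
  coeff-fromFunction-∉ []      c e∉L = refl
  coeff-fromFunction-∉ (f ∷ L) c {e} e∉L = trans (coeff-∷ (c f) f (fromFunction L c) e)
    (trans (+-cong (trans (*-congˡ (δ-≢ λ f≡e → e∉L (here (≡.sym f≡e)))) (zeroʳ _)) (coeff-fromFunction-∉ L c (e∉L ∘ there))) (+-identityˡ 0#))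

  coeff-fromFunction-∈ : ∀ {n} (L : List (Mono n)) c {e} → Unique L → e ∈ L → coeff (fromFunction L c) e ≈ c e
  coeff-fromFunction-∈ (f ∷ L) c {e} uniq@(_ ∷ _) (here ≡.refl) = trans (coeff-∷ (c f) f (fromFunction L c) e)
    (trans (+-cong (trans (*-congˡ (δ-≡ {f = f} ≡.refl)) (*-identityʳ _)) (coeff-fromFunction-∉ L c (Unique.Unique[x∷xs]⇒x∉xs uniq))) (+-identityʳ _))
  coeff-fromFunction-∈ (f ∷ L) c {e} (f∉L ∷ uniq) (there e∈L) = trans (coeff-∷ (c f) f (fromFunction L c) e)
    (trans (+-cong (trans (*-congˡ (δ-≢ (All.lookup f∉L e∈L))) (zeroʳ _)) (coeff-fromFunction-∈ L c uniq e∈L)) (+-identityˡ _))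

  coeff-fromFunction-box : ∀ {n} d (c : Mono n → K) → (∀ e → deg e ≢ d → c e ≈ 0#) →
    ∀ e → coeff (fromFunction (box n d) c) e ≈ c e
  coeff-fromFunction-box {n} d c c≈0 e with e ∈? box n d
    where open Data.List.Membership.DecPropositional (Vec.≡-dec ℕ._≟_) using (_∈?_)
  ... | yes e∈ = coeff-fromFunction-∈ (box n d) c (unique-box n d) e∈
  ... | no  e∉ = trans (coeff-fromFunction-∉ (box n d) c e∉) (sym (c≈0 e λ deg≡ → e∉ (∈-box e (ℕ.≤-reflexive deg≡))))

  coeff-lincomb : ∀ {n k} (as : Vec K k) (bs : Vec (Poly n) k) e →
    coeff (lincomb as bs) e ≈ lookup as ∙ (λ j → coeff (lookup bs j) e)
  coeff-lincomb []       []       e = refl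
  coeff-lincomb (a ∷ as) (b ∷ bs) e = trans (coeff-+ (a ·ₚ b) (lincomb as bs) e) (+-cong (coeff-· a b e) (coeff-lincomb as bs e))

-- Δ(M) as the solution space of the relations; subspace and grading.

module DeltaSpace {c ℓ : Level} (R : CommutativeRing c ℓ) (isField : IsField R) (char0 : Over.CharZero R)
  {n : ℕ} (M : Over.Matrix R n) where
  open CommutativeRing R hiding (zero) renaming (Carrier to K)
  open Over R
  open Arithmetic R
  open Solver using (solve; _:=_; _:+_; _:*_)
  open Coefficients R
  open IsField isField
  open Relation.Binary.Reasoning.Setoid setoid

  nonZero-inverse : ∀ m → NonZero m → ∃ λ y → fromℕ m * y ≈ 1#
  nonZero-inverse (suc m) _ = inverse (fromℕ (suc m)) (char0 m)

  factorial⁻¹ : Mono n → K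
  factorial⁻¹ e = proj₁ (nonZero-inverse (factorial e) (factorial-nonZero e))

  factorial-inverse : ∀ e → fromℕ (factorial e) * factorial⁻¹ e ≈ 1#
  factorial-inverse e = proj₂ (nonZero-inverse (factorial e) (factorial-nonZero e))

  factorial-cancel : ∀ e {x} → fromℕ (factorial e) * x ≈ 0# → x ≈ 0#
  factorial-cancel e {x} eq = begin
    x                                                 ≈⟨ *-identityˡ x ⟨
    1# * x                                            ≈⟨ *-congʳ (factorial-inverse e) ⟨
    fromℕ (factorial e) * factorial⁻¹ e * x           ≈⟨ solve 3 (λ a b x → a :* b :* x := b :* (a :* x)) refl _ _ x ⟩
    factorial⁻¹ e * (fromℕ (factorial e) * x)         ≈⟨ trans (*-congˡ eq) (zeroʳ _) ⟩
    0#                                                ∎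

  -- In terms of the numbers e! cₑ differentiation is an index shift.
  weighted : (Mono n → K) → Mono n → K
  weighted c e = fromℕ (factorial e) * c e

  weighted-derivative : ∀ j c e → fromℕ (factorial e) * derivative j c e ≈ weighted c (inc j e)
  weighted-derivative j c e = begin
    fromℕ (factorial e) * (fromℕ (suc (lookup e j)) * c (inc j e))    ≈⟨ solve 3 (λ a b x → a :* (b :* x) := b :* a :* x) refl _ _ _ ⟩
    fromℕ (suc (lookup e j)) * fromℕ (factorial e) * c (inc j e)      ≈⟨ *-congʳ (fromℕ-* (suc (lookup e j)) (factorial e)) ⟨
    fromℕ (suc (lookup e j) ℕ.* factorial e) * c (inc j e)            ≡⟨ ≡.cong (λ m → fromℕ m * c (inc j e)) (factorial-inc j e) ⟨
    weighted c (inc j e)                                              ∎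

  module _ (i : Fin n) where
    open Calculus R (M i)
    open Exponential isField char0 using (∂-shift⇒D; D⇒∂-shift)

    weighted-D : ∀ c e → fromℕ (factorial e) * D (derivative i c) e ≈ M i ∙ (λ j → weighted c (inc j (inc i e)))
    weighted-D c e = begin
      a * M i ∙ (λ j → derivative j (derivative i c) e)                          ≈⟨ ∙-scaleʳ (M i) _ a ⟨
      M i ∙ (λ j → a * derivative j (derivative i c) e)                          ≈⟨ ∙-congʳ (M i) twice ⟩
      M i ∙ (λ j → weighted c (inc j (inc i e)))                                 ∎
      where
      a = fromℕ (factorial e)
      twice : ∀ j → a * derivative j (derivative i c) e ≈ weighted c (inc j (inc i e))
      twice j = begin
        a * derivative j (derivative i c) e    ≈⟨ weighted-derivative j (derivative i c) e ⟩
        weighted (derivative i c) (inc j e)    ≈⟨ weighted-derivative i c (inc j e) ⟩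
        weighted c (inc i (inc j e))           ≡⟨ ≡.cong (weighted c) (inc-comm i j e) ⟩
        weighted c (inc j (inc i e))           ∎

    row⇒relation : ∀ p → ∂ i (Δᵢ M i p) ≈ₚ 0ₚ → ∀ e → M i ∙ (λ j → weighted (coeff p) (inc j (inc i e))) ≈ 0#
    row⇒relation p ∂≈0 e = trans (sym (weighted-D (coeff p) e)) (trans (*-congˡ (∂-shift⇒D i p ∂≈0 e)) (zeroʳ _))

    relation⇒row : ∀ p → (∀ e → M i ∙ (λ j → weighted (coeff p) (inc j (inc i e))) ≈ 0#) → ∂ i (Δᵢ M i p) ≈ₚ 0ₚ
    relation⇒row p rel = D⇒∂-shift i p (λ e → factorial-cancel e (trans (weighted-D (coeff p) e) (rel e)))

  InΔ⇒Relations : ∀ p → InΔ M p → Relations R M (weighted (coeff p))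
  InΔ⇒Relations p p∈Δ i = row⇒relation i p (p∈Δ i)

  Relations⇒InΔ : ∀ p → Relations R M (weighted (coeff p)) → InΔ M p
  Relations⇒InΔ p rel i = relation⇒row i p (rel i)

  Relations-cong : ∀ {f g} → (∀ e → f e ≈ g e) → Relations R M f → Relations R M g
  Relations-cong f≈g rel i e = trans (∙-congʳ (M i) (λ j → sym (f≈g (inc j (inc i e))))) (rel i e)

  Relations-zero : Relations R M (λ _ → 0#)
  Relations-zero i e = ∙-zeroʳ (M i) _ (λ _ → refl)

  Relations-linear : ∀ {f g} a → Relations R M f → Relations R M g → Relations R M (λ e → f e + a * g e)
  Relations-linear a relf relg i e = trans (∙-linearʳ (M i) _ _ a)
    (trans (+-cong (relf i e) (trans (*-congˡ (relg i e)) (zeroʳ a))) (+-identityˡ 0#))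

  InΔ-resp : ∀ {p q} → p ≈ₚ q → InΔ M p → InΔ M q
  InΔ-resp {p} {q} p≈q p∈Δ = Relations⇒InΔ q (Relations-cong (λ e → *-congˡ {fromℕ (factorial e)} (p≈q e)) (InΔ⇒Relations p p∈Δ))

  InΔ-zero : InΔ M 0ₚ
  InΔ-zero = Relations⇒InΔ 0ₚ (Relations-cong (λ e → sym (zeroʳ (fromℕ (factorial e)))) Relations-zero)

  -- Sums, multiples and differences are all instances of this one combination.
  InΔ-+· : ∀ {p q} a → InΔ M p → InΔ M q → InΔ M (p +ₚ a ·ₚ q)
  InΔ-+· {p} {q} a p∈Δ q∈Δ = Relations⇒InΔ (p +ₚ a ·ₚ q) (Relations-cong
    (λ e → trans (solve 4 (λ m x a y → m :* x :+ a :* (m :* y) := m :* (x :+ a :* y)) refl (fromℕ (factorial e)) (coeff p e) a (coeff q e))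
      (*-congˡ (sym (trans (coeff-+ p (a ·ₚ q) e) (+-congˡ (coeff-· a q e))))))
    (Relations-linear {weighted (coeff p)} {weighted (coeff q)} a (InΔ⇒Relations p p∈Δ) (InΔ⇒Relations q q∈Δ)))

  InΔ-+ : ∀ {p q} → InΔ M p → InΔ M q → InΔ M (p +ₚ q)
  InΔ-+ {p} {q} p∈Δ q∈Δ = InΔ-resp {p +ₚ 1# ·ₚ q} {p +ₚ q}
    (λ e → trans (coeff-+ p (1# ·ₚ q) e) (trans (+-congˡ (trans (coeff-· 1# q e) (*-identityˡ _))) (sym (coeff-+ p q e))))
    (InΔ-+· {p} {q} 1# p∈Δ q∈Δ)

  InΔ-· : ∀ a {p} → InΔ M p → InΔ M (a ·ₚ p)
  InΔ-· a {p} = InΔ-+· {0ₚ} {p} a InΔ-zero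

  InΔ-isSubspace : IsSubspace (InΔ M)
  InΔ-isSubspace = (λ {p} {q} → InΔ-resp {p} {q}) , InΔ-zero , (λ {p} {q} → InΔ-+ {p} {q}) , (λ a {p} → InΔ-· a {p})

  -- The relation at `i` and `e` involves coefficients of the single degree `suc (suc (deg e))`, so
  -- a component either inherits it from `p` or satisfies it trivially.
  InΔ-isGraded : IsGraded (InΔ M)
  InΔ-isGraded p p∈Δ d = Relations⇒InΔ (component d p) rel
    where
    deg-inc² : ∀ j i e → deg (inc j (inc i e)) ≡ suc (suc (deg e))
    deg-inc² j i e = ≡.trans (sum-inc j (inc i e)) (≡.cong suc (sum-inc i e))
    rel : Relations R M (weighted (coeff (component d p)))
    rel i e with suc (suc (deg e)) ℕ.≟ d
    ... | yes deg≡ = trans (∙-congʳ (M i) (λ j → *-congˡ (coeff-component-≡ R d p _ (≡.trans (deg-inc² j i e) deg≡)))) (InΔ⇒Relations p p∈Δ i e)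
    ... | no  deg≢ = ∙-zeroʳ (M i) _ (λ j → trans (*-congˡ (coeff-component-≢ R d p _ (deg≢ ∘ ≡.trans (≡.sym (deg-inc² j i e))))) (zeroʳ _))

  InΔ-lincomb : ∀ {k} (as : Vec K k) (bs : Vec (Poly n) k) → (∀ j → InΔ M (lookup bs j)) → InΔ M (lincomb as bs)
  InΔ-lincomb []       []       bs∈Δ = InΔ-zero
  InΔ-lincomb (a ∷ as) (b ∷ bs) bs∈Δ =
    InΔ-+ {a ·ₚ b} {lincomb as bs} (InΔ-· a {b} (bs∈Δ zero)) (InΔ-lincomb as bs (bs∈Δ ∘ suc))

  -- The dual basis and the dimensions.

  module Basis (minors≉0 : ∀ J → Nonempty J → ¬ (principalMinor M J ≈ 0#)) where
    open Operators R M (regular R isField M minors≉0)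

    dual : Subset n → Subset n → K
    dual J J′ with Vec.≡-dec Bool._≟_ J J′
    ... | yes _ = 1#
    ... | no  _ = 0#

    dual-≡ : ∀ {J J′} → J ≡ J′ → dual J J′ ≈ 1#
    dual-≡ {J} {J′} J≡ with Vec.≡-dec Bool._≟_ J J′
    ... | yes _  = refl
    ... | no  J≢ = contradiction J≡ J≢

    dual-≢ : ∀ {J J′} → J ≢ J′ → dual J J′ ≈ 0#
    dual-≢ {J} {J′} J≢ with Vec.≡-dec Bool._≟_ J J′
    ... | yes J≡ = contradiction J≡ J≢
    ... | no  _  = refl

    -- The polynomial whose linear form is dual to y_J: the factor 1/e! undoes `weighted`. A finite
    -- list suffices because the form lives in degree `∣ J ∣`.
    element : Subset n → Poly n
    element J = fromFunction R (box n ∣ J ∣) (λ e → factorial⁻¹ e * moment (dual J) e)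

    moment-dual-≢ : ∀ J e → deg e ≢ ∣ J ∣ → moment (dual J) e ≈ 0#
    moment-dual-≢ J = moment-supported (λ J′ size≢ → dual-≢ {J} {J′} λ J≡ → size≢ (≡.cong ∣_∣ (≡.sym J≡)))

    coeff-element : ∀ J e → coeff (element J) e ≈ factorial⁻¹ e * moment (dual J) e
    coeff-element J = coeff-fromFunction-box R ∣ J ∣ _ (λ e deg≢ → trans (*-congˡ (moment-dual-≢ J e deg≢)) (zeroʳ _))

    weighted-element : ∀ J e → weighted (coeff (element J)) e ≈ moment (dual J) e
    weighted-element J e = begin
      fromℕ (factorial e) * coeff (element J) e                        ≈⟨ *-congˡ (coeff-element J e) ⟩
      fromℕ (factorial e) * (factorial⁻¹ e * moment (dual J) e)        ≈⟨ *-assoc _ _ _ ⟨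
      fromℕ (factorial e) * factorial⁻¹ e * moment (dual J) e          ≈⟨ *-congʳ (factorial-inverse e) ⟩
      1# * moment (dual J) e                                           ≈⟨ *-identityˡ _ ⟩
      moment (dual J) e                                                ∎

    element-InΔ : ∀ J → InΔ M (element J)
    element-InΔ J = Relations⇒InΔ (element J) (Relations-cong (λ e → sym (weighted-element J e)) (moment-relations (dual J)))

    element-homogeneous : ∀ J → Homogeneous ∣ J ∣ (element J)
    element-homogeneous J e deg≢ = factorial-cancel e (trans (weighted-element J e) (moment-dual-≢ J e deg≢))

    weighted-squarefree : ∀ c J → weighted c (squarefree J) ≈ c (squarefree J)
    weighted-squarefree c J = begin
      fromℕ (factorial (squarefree J)) * c (squarefree J)  ≡⟨ ≡.cong (λ m → fromℕ m * c (squarefree J)) (factorial-squarefree J) ⟩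
      (1# + 0#) * c (squarefree J)                         ≈⟨ trans (*-congʳ (+-identityʳ 1#)) (*-identityˡ _) ⟩
      c (squarefree J)                                     ∎

    -- On squarefree exponents e! is 1, so squarefree coefficients are themselves the coordinates
    -- with respect to the dual basis.
    coeff-element-squarefree : ∀ J J′ → coeff (element J) (squarefree J′) ≈ dual J J′
    coeff-element-squarefree J J′ = begin
      coeff (element J) (squarefree J′)             ≈⟨ weighted-squarefree (coeff (element J)) J′ ⟨
      weighted (coeff (element J)) (squarefree J′)  ≈⟨ weighted-element J (squarefree J′) ⟩
      moment (dual J) (squarefree J′)               ≈⟨ moment-squarefree (dual J) J′ ⟩
      dual J J′                                     ∎

    InΔ-vanish : ∀ p → InΔ M p → (∀ J → coeff p (squarefree J) ≈ 0#) → p ≈ₚ 0ₚ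
    InΔ-vanish p p∈Δ p≈0 e = factorial-cancel e (relations-vanish (deg e) (weighted (coeff p)) (InΔ⇒Relations p p∈Δ)
      (λ J → trans (weighted-squarefree (coeff p) J) (p≈0 J)) e ≡.refl)

    -- Stated for a part of Δ(M) described by a list of subsets, so that it covers both a graded
    -- piece and the whole space.
    hasDim : ∀ {ℓ′} (L : Poly n → Set ℓ′) (Js : List (Subset n)) → Unique Js → (∀ {J} → J ∈ Js → L (element J)) →
      (∀ p → L p → InΔ M p) → (∀ p → L p → ∀ J → J ∉ Js → coeff p (squarefree J) ≈ 0#) → HasDim L (length Js)
    hasDim L Js uniq element∈L L⊆Δ L≈0 = b , b∈L , independent , spanning
      where
      open Data.List.Membership.DecPropositional (Vec.≡-dec Bool._≟_) using (_∈?_)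
      at : Fin (length Js) → Subset n
      at = List.lookup Js

      b : Vec (Poly n) (length Js)
      b = Vec.tabulate (element ∘ at)

      lookup-b : ∀ j → lookup b j ≡ element (at j)
      lookup-b = Vec.lookup∘tabulate (element ∘ at)

      b∈L : ∀ j → L (lookup b j)
      b∈L j = ≡.subst L (≡.sym (lookup-b j)) (element∈L (List.∈-lookup j))

      coeff-b : ∀ j J → coeff (lookup b j) (squarefree J) ≈ dual (at j) J
      coeff-b j J = trans (reflexive (≡.cong (λ p → coeff p (squarefree J)) (lookup-b j))) (coeff-element-squarefree (at j) J)

      coeff-lincomb-at : ∀ as j → coeff (lincomb as b) (squarefree (at j)) ≈ lookup as j
      coeff-lincomb-at as j = begin
        coeff (lincomb as b) (squarefree (at j))                            ≈⟨ coeff-lincomb R as b _ ⟩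
        lookup as ∙ (λ i → coeff (lookup b i) (squarefree (at j)))          ≈⟨ ∙-congʳ (lookup as) (λ i → coeff-b i (at j)) ⟩
        lookup as ∙ (λ i → dual (at i) (at j))                              ≈⟨ sum-single _ j (λ i i≢j → trans (*-congˡ (dual-≢ (i≢j ∘ lookup-injective uniq i j))) (zeroʳ _)) ⟩
        lookup as j * dual (at j) (at j)                                    ≈⟨ trans (*-congˡ (dual-≡ {at j} ≡.refl)) (*-identityʳ _) ⟩
        lookup as j                                                         ∎

      coeff-lincomb-∉ : ∀ as {J} → J ∉ Js → coeff (lincomb as b) (squarefree J) ≈ 0#
      coeff-lincomb-∉ as {J} J∉Js = trans (coeff-lincomb R as b _) (∙-zeroʳ (lookup as) _
        (λ i → trans (coeff-b i J) (dual-≢ λ at≡J → J∉Js (≡.subst (_∈ Js) at≡J (List.∈-lookup i)))))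

      independent : ∀ as → lincomb as b ≈ₚ 0ₚ → ∀ j → lookup as j ≈ 0#
      independent as lincomb≈0 j = trans (sym (coeff-lincomb-at as j)) (lincomb≈0 (squarefree (at j)))

      spanning : ∀ p → L p → Σ (Vec K (length Js)) λ as → p ≈ₚ lincomb as b
      -- The coordinates are the squarefree coefficients of `p`. The difference lies in Δ(M) and has
      -- no squarefree coefficients left, so `InΔ-vanish` makes it zero.
      spanning p p∈L = as , λ e → x-y≈0⇒x≈y (trans (sym (coeff-- p (lincomb as b) e)) (InΔ-vanish (p -ₚ lincomb as b)
        (InΔ-+· {p} {lincomb as b} (- 1#) (L⊆Δ p p∈L) (InΔ-lincomb as b (λ j → L⊆Δ _ (b∈L j))))
        (λ J → trans (coeff-- p (lincomb as b) (squarefree J)) (difference J)) e))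
        where
        as = Vec.tabulate (λ j → coeff p (squarefree (at j)))
        equal : ∀ j → coeff p (squarefree (at j)) ≈ coeff (lincomb as b) (squarefree (at j))
        equal j = sym (trans (coeff-lincomb-at as j) (reflexive (Vec.lookup∘tabulate _ j)))
        difference : ∀ J → coeff p (squarefree J) - coeff (lincomb as b) (squarefree J) ≈ 0#
        difference J with J ∈? Js
        ... | no J∉Js = trans (+-cong (L≈0 p p∈L J J∉Js) (-‿cong (coeff-lincomb-∉ as J∉Js))) (-‿inverseʳ 0#)
        ... | yes J∈Js with Any.index J∈Js | Any.lookup-index J∈Js
        ...   | j | ≡.refl = trans (+-congʳ (equal j)) (-‿inverseʳ _)

    hasDim-homogeneous : ∀ d → HasDim (InΔ M [ d ]) (n C d)
    hasDim-homogeneous d = ≡.subst (HasDim (InΔ M [ d ])) (length-ofSize n d)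
      (hasDim (InΔ M [ d ]) (ofSize n d) (unique-ofSize n d)
        (λ {J} J∈ → element-InΔ J , ≡.subst (λ d → Homogeneous d (element J)) (∈-ofSize⁻ n d J∈) (element-homogeneous J))
        (λ p → proj₁)
        (λ p p∈ J J∉ → proj₂ p∈ (squarefree J) λ deg≡ →
          J∉ (≡.subst (λ d → J ∈ ofSize n d) (≡.trans (≡.sym (sum-squarefree J)) deg≡) (∈-ofSize⁺ J))))

    hasDim-total : HasDim (InΔ M) (2 ^ n)
    hasDim-total = ≡.subst (HasDim (InΔ M)) (length-subsets n)
      (hasDim (InΔ M) (subsets n) (unique-subsets n) (λ {J} _ → element-InΔ J) (λ p → id)
        (λ p p∈ J J∉ → contradiction (∈-subsets J) J∉))

theorem2p15 : ∀ {c ℓ : Level} (R : CommutativeRing c ℓ) → IsField R → Over.CharZero R →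
    ∀ (n : ℕ) → 1 ≤ n → (M : Over.Matrix R n) →
    (∀ (J : Subset n) → Nonempty J → ¬ (CommutativeRing._≈_ R (Over.principalMinor R M J) (CommutativeRing.0# R))) →
    (Over.IsSubspace R (Over.InΔ R M) × Over.IsGraded R (Over.InΔ R M)) ×
    (∀ (d : ℕ) → (d ≤ n → Over.HasDim R (Over._[_] R (Over.InΔ R M) d) (n C d))
    × (n < d → Over.HasDim R (Over._[_] R (Over.InΔ R M) d) 0)) ×
    Over.HasDim R (Over.InΔ R M) (2 ^ n)
theorem2p15 R isField char0 n _ M minors≉0 =
    (InΔ-isSubspace , InΔ-isGraded)
  , (λ d → (λ _ → hasDim-homogeneous d)
         , (λ n<d → ≡.subst (Over.HasDim R (Over._[_] R (Over.InΔ R M) d)) (k>n⇒nCk≡0 n<d) (hasDim-homogeneous d)))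
  , hasDim-total
  where
  open DeltaSpace R isField char0 M
  open Basis minors≉0
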